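{- Let $\Sigma,\Sigma'$ be disjoint signatures and let $\mathcal{U},\mathcal{U}'$ be basic quantitative equational theories of type $\Sigma$ and $\Sigma'$ respectively. Then the monad $T_{\mathcal{U}\otimes\mathcal{U}'}$ on $\mathbf{Met}$ is the tensor of monads $T_{\mathcal{U}}\otimes T_{\mathcal{U}'}$ (that is, the tensor $T_{\mathcal{U}}\otimes T_{\mathcal{U}'}$ exists and is isomorphic, as a monad, to $T_{\mathcal{U}\otimes\mathcal{U}'}$).
   Context: An extended metric space is a set $X$ with $d_X:X\times X\to[0,\infty]$ satisfying $d_X(x,y)=0$ iff $x=y$, symmetry and the triangle inequality. $\mathbf{Met}$ is the category of extended metric spaces and non-expansive maps. Quantitative theories. A signature $\Sigma$ is a set of function symbols $f:n$ of finite arity $n\in\mathbb{N}$. Fix a countably infinite set of variables $V$; terms are $\Sigma$-terms over $V$. A quantitative equation is an expression $t=_\varepsilon s$ with $t,s$ terms and $\varepsilon\in\mathbb{Q}_{\ge0}$. A conditional quantitative equation is $\Gamma\vdash t=_\varepsilon s$ with $\Gamma$ a finite set of quantitative equations. A quantitative equational theory of type $\Sigma$ is a set $\mathcal{U}$ of conditional quantitative equations containing (for all variables and rationals $\varepsilon,\varepsilon'\ge 0$) $\vdash x=_0x$; $\{x=_\varepsilon y\}\vdash y=_\varepsilon x$; $\{x=_\varepsilon z,z=_{\varepsilon'}y\}\vdash x=_{\varepsilon+\varepsilon'}y$; $\{x=_\varepsilon y\}\vdash x=_{\varepsilon+\varepsilon'}y$ for $\varepsilon'>0$; $\{x_i=_\varepsilon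 y_i\mid i=1,\dots,n\}\vdash f(x_1,\dots,x_n)=_\varepsilon f(y_1,\dots,y_n)$ for $f:n\in\Sigma$; and closed under: continuity (if $\Gamma\vdash t=_{\varepsilon'}s\in\mathcal{U}$ for all $\varepsilon'>\varepsilon$ then $\Gamma\vdash t=_\varepsilon s\in\mathcal{U}$), substitution of terms for variables, assumption ($\Gamma\vdash\phi\in\mathcal{U}$ whenever $\phi\in\Gamma$), and cut (if $\Gamma\vdash\phi\in\mathcal{U}$ for all $\phi\in\Theta$ and $\Theta\vdash\psi\in\mathcal{U}$ then $\Gamma\vdash\psi\in\mathcal{U}$). A set $A$ of conditional quantitative equations axiomatizes $\mathcal{U}$ if $\mathcal{U}$ is the smallest theory containing $A$. $\mathcal{U}$ is basic if it is axiomatized by a set of conditional quantitative equations of the form $\{x_1=_{\varepsilon_1}y_1,\dots,x_n=_{\varepsilon_n}y_n\}\vdash t=_\varepsilon s$ with all $x_i,y_i$ variables. Models. A quantitative $\Sigma$-algebra is an extended metric space $A$ with, for each $f:n\in\Sigma$, a map $f^A:A^n\to A$ that is non-expansive for the max metric on $A^n$. It satisfies $\Gamma\vdash t=_\varepsilon s$ if for every assignment $\iota:V\to A$ (extended homomorphically to terms), $d_A(\iota(t'),\iota(s'))\le\varepsilon'$ for all $t'=_{\varepsilon'}s'\in\Gamma$ implies $d_A(\iota(t),\iota(s))\le\varepsilon$. $\mathbb{K}(\Sigma,\mathcal{U})$ is the category of quantitative $\Sigma$-algebras satisfying all members of $\mathcal{U}$, with non-expansive $\Sigma$-homomorphisms.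 The forgetful functor $\mathbb{K}(\Sigma,\mathcal{U})\to\mathbf{Met}$ has a left adjoint (known result); $T_{\mathcal{U}}$ denotes the induced monad on $\mathbf{Met}$. Tensor of theories. For disjoint $\Sigma,\Sigma'$, $\mathcal{U}\otimes\mathcal{U}'$ is the smallest quantitative equational theory of type $\Sigma\cup\Sigma'$ containing $\mathcal{U}$, $\mathcal{U}'$ and, for all $f:n\in\Sigma$ and $g:m\in\Sigma'$, the equation $$\vdash f(g(x^1_1,\dots,x^1_m),\dots,g(x^n_1,\dots,x^n_m))=_0 g(f(x^1_1,\dots,x^n_1),\dots,f(x^1_m,\dots,x^n_m)).$$ Tensor of strong monads. $\mathbf{Met}$ is symmetric monoidal closed: $X\square Y$ is $X\times Y$ with $d((x,y),(x',y'))=d_X(x,x')+d_Y(y,y')$, the unit is the one-point space, and the internal hom $Y^X=[X,Y]$ is the set of non-expansive maps with metric $\sup_{x}d_Y(f(x),g(x))$. Strong functors, strong natural transformations and strong monads are taken with respect to $\square$; a strength $t_{X,Y}:X\square FY\to F(X\square Y)$ is necessarily $t(x,u)=F(y\mapsto(x,y))(u)$, and each $T_{\mathcal{U}}$ is strong. For $v\in\mathbf{Met}$, $(-)^v$ is a strong functor. For a strong endofunctor $F$ and an $F$-algebra $(A,a:FA\to A)$, its $v$-power is $(A,a)^v=(A^v,\bar a)$ with $\bar a(u)(p)=a(F(\mathrm{ev}_p)(u))$ for $u\in F(A^v)$, $p\in v$, where $\mathrm{ev}_p:A^v\to A$ is evaluation at $p$. A $v$-ary pre-operation of $F$ is a strong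 natural transformation $g:(-)^v\Rightarrow F$; set $a^g=a\circ g_A:A^v\to A$. For strong monads $T,T'$ on $\mathbf{Met}$, an Eilenberg–Moore tensor $\langle T,T'\rangle$-algebra is a triple $(A,a,b)$ with $(A,a)$ an Eilenberg–Moore $T$-algebra and $(A,b)$ an Eilenberg–Moore $T'$-algebra such that for all $v\in\mathbf{Met}$ and all $v$-ary pre-operations $g$ of $T$, $a^g$ is a $T'$-homomorphism $(A,b)^v\to(A,b)$ (this is equivalent to the condition with the roles of $T$ and $T'$ exchanged). Morphisms are non-expansive maps that are both $T$- and $T'$-homomorphisms. If the forgetful functor from this category to $\mathbf{Met}$ has a left adjoint, the monad induced by the adjunction is the tensor $T\otimes T'$. -}

module Defs where

open import Level using (Level; _⊔_) renaming (suc to lsuc; zero to 0ℓ)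
open import Data.Nat.Base using (ℕ)
open import Data.Fin.Base using (Fin)
open import Data.Unit.Polymorphic.Base using (⊤; tt)
open import Data.Product.Base using (_×_; _,_; proj₁; proj₂; ∃-syntax)
open import Data.Sum.Base using (_⊎_; inj₁; inj₂) renaming ([_,_] to either)
open import Data.List.Base using (List; []; _∷_; map; tabulate)
open import Data.List.Membership.Propositional using (_∈_)
open import Data.Rational.Base as ℚ using (ℚ; 0ℚ)
import Data.Rational.Properties as ℚ
open import Data.Refinement.Base using (Refinement-syntax; value) renaming (_,_ to _,ᵣ_)
open import Data.Irrelevant using ([_])
open import Relation.Nullary.Decidable using (recompute)
open import Relation.Binary.Core using (Rel)
open import Relation.Binary.Structures using (IsEquivalence)
open import Relation.Binary.Bundles using (Setoid)
import Relation.Binary.Reasoning.Setoid as SetoidReasoning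
open import Relation.Binary.PropositionalEquality as ≡ using (_≡_)

private
  variable
    ℓ o e o′ ℓ′ e′ : Level

------------------------------------------------------------------------
-- Categories, adjunctions, monads

record Category (o ℓ e : Level) : Set (lsuc (o ⊔ ℓ ⊔ e)) where
  infix  4 _≈_ _⇒_
  infixr 9 _∘_
  field
    Obj : Set o
    _⇒_ : Obj → Obj → Set ℓ
    _≈_ : ∀ {A B} → Rel (A ⇒ B) e
    id  : ∀ {A} → A ⇒ A
    _∘_ : ∀ {A B C} → B ⇒ C → A ⇒ B → A ⇒ C
    isEquivalence : ∀ {A B} → IsEquivalence (_≈_ {A} {B})
    ∘-resp-≈  : ∀ {A B C} {f h : B ⇒ C} {g i : A ⇒ B} →
                f ≈ h → g ≈ i → f ∘ g ≈ h ∘ i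
    identityˡ : ∀ {A B} {f : A ⇒ B} → id ∘ f ≈ f
    identityʳ : ∀ {A B} {f : A ⇒ B} → f ∘ id ≈ f
    assoc     : ∀ {A B C D} {f : A ⇒ B} {g : B ⇒ C} {h : C ⇒ D} →
                (h ∘ g) ∘ f ≈ h ∘ (g ∘ f)

  homSetoid : Obj → Obj → Setoid ℓ e
  homSetoid A B = record { isEquivalence = isEquivalence {A} {B} }

  module Eq {A B : Obj} = IsEquivalence (isEquivalence {A} {B})
  module Reasoning {A B : Obj} = SetoidReasoning (homSetoid A B)

record Functor (C : Category o ℓ e) (D : Category o′ ℓ′ e′)
       : Set (o ⊔ ℓ ⊔ e ⊔ o′ ⊔ ℓ′ ⊔ e′) where
  private
    module C = Category C
    module D = Category D
  field
    F₀ : C.Obj → D.Obj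
    F₁ : ∀ {X Y} → X C.⇒ Y → F₀ X D.⇒ F₀ Y
    F-resp-≈     : ∀ {X Y} {f g : X C.⇒ Y} → f C.≈ g → F₁ f D.≈ F₁ g
    identity     : ∀ {X} → F₁ (C.id {X}) D.≈ D.id
    homomorphism : ∀ {X Y Z} {f : X C.⇒ Y} {g : Y C.⇒ Z} →
                   F₁ (g C.∘ f) D.≈ F₁ g D.∘ F₁ f

idF : {C : Category o ℓ e} → Functor C C
idF {C = C} = record
  { F₀ = λ X → X
  ; F₁ = λ f → f
  ; F-resp-≈ = λ p → p
  ; identity = Category.Eq.refl C
  ; homomorphism = Category.Eq.refl C
  }

infixr 9 _∘F_
_∘F_ : {o₁ ℓ₁ e₁ : Level}
       {C : Category o ℓ e} {D : Category o′ ℓ′ e′} {E : Category o₁ ℓ₁ e₁} →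
       Functor D E → Functor C D → Functor C E
_∘F_ {E = E} G F = record
  { F₀ = λ X → G.F₀ (F.F₀ X)
  ; F₁ = λ f → G.F₁ (F.F₁ f)
  ; F-resp-≈ = λ p → G.F-resp-≈ (F.F-resp-≈ p)
  ; identity = E.Eq.trans (G.F-resp-≈ F.identity) G.identity
  ; homomorphism = E.Eq.trans (G.F-resp-≈ F.homomorphism) G.homomorphism
  }
  where
  module E = Category E
  module G = Functor G
  module F = Functor F

record NaturalTransformation {C : Category o ℓ e} {D : Category o′ ℓ′ e′}
       (F G : Functor C D) : Set (o ⊔ ℓ ⊔ e ⊔ o′ ⊔ ℓ′ ⊔ e′) where
  private
    module C = Category C
    module D = Category D
    module F = Functor F
    module G = Functor G
  field
    η       : ∀ X → F.F₀ X D.⇒ G.F₀ X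
    commute : ∀ {X Y} (f : X C.⇒ Y) → η Y D.∘ F.F₁ f D.≈ G.F₁ f D.∘ η X

record LeftAdjoint {C : Category o ℓ e} {D : Category o′ ℓ′ e′}
       (G : Functor D C) : Set (o ⊔ ℓ ⊔ e ⊔ o′ ⊔ ℓ′ ⊔ e′) where
  private
    module C = Category C
    module D = Category D
    module G = Functor G
  field
    F      : Functor C D
    unit   : NaturalTransformation idF (G ∘F F)
    counit : NaturalTransformation (F ∘F G) idF
  module F      = Functor F
  module unit   = NaturalTransformation unit
  module counit = NaturalTransformation counit
  field
    zig : ∀ X → counit.η (F.F₀ X) D.∘ F.F₁ (unit.η X) D.≈ D.id
    zag : ∀ A → G.F₁ (counit.η A) C.∘ unit.η (G.F₀ A) C.≈ C.id

record Monad (C : Category o ℓ e) : Set (o ⊔ ℓ ⊔ e) where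
  private
    module C = Category C
  field
    T : Functor C C
    η : NaturalTransformation idF T
    μ : NaturalTransformation (T ∘F T) T
  module T = Functor T
  module η = NaturalTransformation η
  module μ = NaturalTransformation μ
  field
    identityˡ : ∀ X → μ.η X C.∘ T.F₁ (η.η X) C.≈ C.id
    identityʳ : ∀ X → μ.η X C.∘ η.η (T.F₀ X) C.≈ C.id
    assoc     : ∀ X → μ.η X C.∘ T.F₁ (μ.η X) C.≈ μ.η X C.∘ μ.η (T.F₀ X)

record MonadIso {C : Category o ℓ e} (S T : Monad C) : Set (o ⊔ ℓ ⊔ e) where
  private
    module C = Category C
    module S = Monad S
    module T = Monad T
  field
    σ : NaturalTransformation S.T T.T
    τ : ∀ X → T.T.F₀ X C.⇒ S.T.F₀ X
  module σ = NaturalTransformation σ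
  field
    isoˡ   : ∀ X → τ X C.∘ σ.η X C.≈ C.id
    isoʳ   : ∀ X → σ.η X C.∘ τ X C.≈ C.id
    unit-∘ : ∀ X → σ.η X C.∘ S.η.η X C.≈ T.η.η X
    mult-∘ : ∀ X → σ.η X C.∘ S.μ.η X C.≈
                   T.μ.η X C.∘ (σ.η (T.T.F₀ X) C.∘ S.T.F₁ (σ.η X))

inducedMonad : {C : Category o ℓ e} {D : Category o′ ℓ′ e′} {G : Functor D C} →
               LeftAdjoint G → Monad C
inducedMonad {C = C} {D} {G} L = record
  { T = G ∘F F
  ; η = unit
  ; μ = record
    { η = λ X → G.F₁ (counit.η (F.F₀ X))
    ; commute = λ f → G-square (counit.commute (F.F₁ f))
    }
  ; identityˡ = λ X → C.Eq.trans (C.Eq.sym G.homomorphism)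
                        (C.Eq.trans (G.F-resp-≈ (zig X)) G.identity)
  ; identityʳ = λ X → zag (F.F₀ X)
  ; assoc = λ X → G-square (counit.commute (counit.η (F.F₀ X)))
  }
  where
  open LeftAdjoint L
  module C = Category C
  module D = Category D
  module G = Functor G
  G-square : ∀ {W X Y Z} {f : X D.⇒ Z} {g : W D.⇒ X} {h : Y D.⇒ Z} {i : W D.⇒ Y} →
             f D.∘ g D.≈ h D.∘ i →
             G.F₁ f C.∘ G.F₁ g C.≈ G.F₁ h C.∘ G.F₁ i
  G-square p = C.Eq.trans (C.Eq.sym G.homomorphism)
                 (C.Eq.trans (G.F-resp-≈ p) G.homomorphism)

record FreeObject {C : Category o ℓ e} {D : Category o′ ℓ′ e′}
       (G : Functor D C) (X : Category.Obj C) : Set (o ⊔ ℓ ⊔ e ⊔ o′ ⊔ ℓ′ ⊔ e′) where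
  private
    module C = Category C
    module D = Category D
    module G = Functor G
  field
    obj        : D.Obj
    η          : X C.⇒ G.F₀ obj
    ext        : ∀ {A} → X C.⇒ G.F₀ A → obj D.⇒ A
    ext-η      : ∀ {A} (f : X C.⇒ G.F₀ A) → G.F₁ (ext f) C.∘ η C.≈ f
    ext-unique : ∀ {A} (f : X C.⇒ G.F₀ A) (h : obj D.⇒ A) →
                 G.F₁ h C.∘ η C.≈ f → h D.≈ ext f

leftAdjoint : {C : Category o ℓ e} {D : Category o′ ℓ′ e′} {G : Functor D C} →
              (∀ X → FreeObject G X) → LeftAdjoint G
leftAdjoint {C = C} {D} {G} free = record
  { F = record
    { F₀ = obj
    ; F₁ = F₁
    ; F-resp-≈ = λ {X} {Y} {f} {g} p →
        ext-unique X _ _ (C.Eq.trans (ext-η X (η Y C.∘ f)) (C.∘-resp-≈ C.Eq.refl p))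
    ; identity = λ {X} → D.Eq.sym (ext-unique X _ _
        (C.Eq.trans (C.∘-resp-≈ G.identity C.Eq.refl)
          (C.Eq.trans C.identityˡ (C.Eq.sym C.identityʳ))))
    ; homomorphism = λ {X} {Y} {Z} {f} {g} → D.Eq.sym (ext-unique X _ _ (begin
        G.F₁ (F₁ g D.∘ F₁ f) C.∘ η X        ≈⟨ G-∘ ⟩
        G.F₁ (F₁ g) C.∘ (G.F₁ (F₁ f) C.∘ η X) ≈⟨ C.∘-resp-≈ C.Eq.refl (ext-η X _) ⟩
        G.F₁ (F₁ g) C.∘ (η Y C.∘ f)          ≈⟨ C.assoc ⟨
        (G.F₁ (F₁ g) C.∘ η Y) C.∘ f          ≈⟨ C.∘-resp-≈ (ext-η Y _) C.Eq.refl ⟩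
        (η Z C.∘ g) C.∘ f                    ≈⟨ C.assoc ⟩
        η Z C.∘ (g C.∘ f)                    ∎))
    }
  ; unit = record { η = η ; commute = λ {X} {Y} f → C.Eq.sym (ext-η X (η Y C.∘ f)) }
  ; counit = record
    { η = counit
    ; commute = λ {A} {B} f → D.Eq.trans
        (ext-unique (G.F₀ A) (G.F₁ f) _ (begin
          G.F₁ (counit B D.∘ F₁ (G.F₁ f)) C.∘ η (G.F₀ A)         ≈⟨ G-∘ ⟩
          G.F₁ (counit B) C.∘ (G.F₁ (F₁ (G.F₁ f)) C.∘ η (G.F₀ A)) ≈⟨ C.∘-resp-≈ C.Eq.refl (ext-η (G.F₀ A) _) ⟩
          G.F₁ (counit B) C.∘ (η (G.F₀ B) C.∘ G.F₁ f)            ≈⟨ C.assoc ⟨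
          (G.F₁ (counit B) C.∘ η (G.F₀ B)) C.∘ G.F₁ f            ≈⟨ C.∘-resp-≈ (ext-η (G.F₀ B) _) C.Eq.refl ⟩
          C.id C.∘ G.F₁ f                                        ≈⟨ C.identityˡ ⟩
          G.F₁ f                                                 ∎))
        (D.Eq.sym (ext-unique (G.F₀ A) (G.F₁ f) _ (begin
          G.F₁ (f D.∘ counit A) C.∘ η (G.F₀ A)          ≈⟨ G-∘ ⟩
          G.F₁ f C.∘ (G.F₁ (counit A) C.∘ η (G.F₀ A))   ≈⟨ C.∘-resp-≈ C.Eq.refl (ext-η (G.F₀ A) _) ⟩
          G.F₁ f C.∘ C.id                               ≈⟨ C.identityʳ ⟩
          G.F₁ f                                        ∎)))
    }
  ; zig = λ X → D.Eq.trans
      (ext-unique X (η X) _ (begin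
        G.F₁ (counit (obj X) D.∘ F₁ (η X)) C.∘ η X           ≈⟨ G-∘ ⟩
        G.F₁ (counit (obj X)) C.∘ (G.F₁ (F₁ (η X)) C.∘ η X)  ≈⟨ C.∘-resp-≈ C.Eq.refl (ext-η X _) ⟩
        G.F₁ (counit (obj X)) C.∘ (η (G.F₀ (obj X)) C.∘ η X) ≈⟨ C.assoc ⟨
        (G.F₁ (counit (obj X)) C.∘ η (G.F₀ (obj X))) C.∘ η X ≈⟨ C.∘-resp-≈ (ext-η _ _) C.Eq.refl ⟩
        C.id C.∘ η X                                         ≈⟨ C.identityˡ ⟩
        η X                                                  ∎))
      (D.Eq.sym (ext-unique X (η X) _
        (C.Eq.trans (C.∘-resp-≈ G.identity C.Eq.refl) C.identityˡ)))
  ; zag = λ A → ext-η (G.F₀ A) C.id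
  }
  where
  module C = Category C
  module D = Category D
  module G = Functor G
  open module Free X = FreeObject (free X) using (obj; η; ext; ext-η; ext-unique)
  open C.Reasoning
  F₁ : ∀ {X Y} → X C.⇒ Y → obj X D.⇒ obj Y
  F₁ {X} {Y} f = ext X (η Y C.∘ f)
  counit : ∀ A → obj (G.F₀ A) D.⇒ A
  counit A = ext (G.F₀ A) C.id
  G-∘ : ∀ {W X Y Z} {f : X D.⇒ Y} {g : W D.⇒ X} {h : Z C.⇒ G.F₀ W} →
        G.F₁ (f D.∘ g) C.∘ h C.≈ G.F₁ f C.∘ (G.F₁ g C.∘ h)
  G-∘ = C.Eq.trans (C.∘-resp-≈ G.homomorphism C.Eq.refl) C.assoc

------------------------------------------------------------------------
-- Non-negative rationals and the extended half-line

ℚ≥0 : Set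
ℚ≥0 = [ q ∈ ℚ ∣ 0ℚ ℚ.≤ q ]

nonNegative : (q : ℚ≥0) → 0ℚ ℚ.≤ value q
nonNegative (q ,ᵣ [ p ]) = recompute (0ℚ ℚ.≤? q) p

0# : ℚ≥0
0# = 0ℚ ,ᵣ [ ℚ.≤-refl ]

infix  4 _≤_ _<_
infixl 6 _+_

_≤_ _<_ : Rel ℚ≥0 0ℓ
p ≤ q = value p ℚ.≤ value q
p < q = value p ℚ.< value q

_+_ : ℚ≥0 → ℚ≥0 → ℚ≥0
p + q = (value p ℚ.+ value q) ,ᵣ [ ℚ.+-mono-≤ (nonNegative p) (nonNegative q) ]

dense : ∀ p q → p < q → ∃[ m ] p < m × m < q
dense p q p<q with ℚ.<-dense p<q
... | m , p<m , m<q =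
  (m ,ᵣ [ ℚ.≤-trans (nonNegative p) (ℚ.<⇒≤ p<m) ]) , p<m , m<q

-- A number r ∈ [0,∞] is given by the set of all rational ε ≥ 0 with r ≤ ε.
-- The sets arising in this way are exactly those that are upward closed and
-- contain ε as soon as they contain all ε′ > ε; ∞ corresponds to the empty set.
record [0,∞] (ℓ : Level) : Set (lsuc ℓ) where
  no-eta-equality
  field
    Bound  : ℚ≥0 → Set ℓ
    upper  : ∀ ε ε′ → ε ≤ ε′ → Bound ε → Bound ε′
    closed : ∀ ε → (∀ ε′ → ε < ε′ → Bound ε′) → Bound ε

-- Record values of this type (and of the two types of spaces and maps below)
-- unfold only when projected from, so that metavariables such as the X in
-- X □ Y can be solved by unification.
{-# INLINE [0,∞].constructor #-}

open [0,∞]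

infix  4 _≤ℚ_ _⊑_ _≐_
infixl 6 _⊞_

_≤ℚ_ : [0,∞] ℓ → ℚ≥0 → Set ℓ
r ≤ℚ ε = Bound r ε

_⊑_ : [0,∞] ℓ → [0,∞] ℓ′ → Set (ℓ ⊔ ℓ′)
r ⊑ s = ∀ ε → s ≤ℚ ε → r ≤ℚ ε

_≐_ : [0,∞] ℓ → [0,∞] ℓ′ → Set (ℓ ⊔ ℓ′)
r ≐ s = r ⊑ s × s ⊑ r

0∞ : [0,∞] ℓ
0∞ = record { Bound = λ _ → ⊤ ; upper = λ _ _ _ _ → tt ; closed = λ _ _ → tt }

_⊞_ : [0,∞] ℓ → [0,∞] ℓ → [0,∞] ℓ
r ⊞ s = record
  { Bound = λ ε → ∀ ε′ → ε < ε′ → ∃[ p ] ∃[ q ] (r ≤ℚ p × s ≤ℚ q × p + q ≤ ε′)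
  ; upper = λ _ _ ε≤ε′ b ε″ ε′<ε″ → b ε″ (ℚ.≤-<-trans ε≤ε′ ε′<ε″)
  ; closed = λ ε b ε″ ε<ε″ →
      let m , ε<m , m<ε″ = dense ε ε″ ε<ε″ in b m ε<m ε″ m<ε″
  }

sup : {I : Set ℓ} → (I → [0,∞] ℓ′) → [0,∞] (ℓ ⊔ ℓ′)
sup r = record
  { Bound = λ ε → ∀ i → r i ≤ℚ ε
  ; upper = λ ε ε′ ε≤ε′ b i → upper (r i) ε ε′ ε≤ε′ (b i)
  ; closed = λ ε b i → closed (r i) ε (λ ε′ ε<ε′ → b ε′ ε<ε′ i)
  }

value-injective : {p q : ℚ≥0} → value p ≡ value q → p ≡ q
value-injective {_ ,ᵣ [ _ ]} {_ ,ᵣ [ _ ]} ≡.refl = ≡.refl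

+-comm : ∀ p q → p + q ≡ q + p
+-comm p q = value-injective (ℚ.+-comm (value p) (value q))

+-assoc : ∀ p q r → (p + q) + r ≡ p + (q + r)
+-assoc p q r = value-injective (ℚ.+-assoc (value p) (value q) (value r))

+-identityˡ : ∀ p → 0# + p ≡ p
+-identityˡ p = value-injective (ℚ.+-identityˡ (value p))

+-identityʳ : ∀ p → p + 0# ≡ p
+-identityʳ p = value-injective (ℚ.+-identityʳ (value p))

+-interchange : ∀ p q r s → (p + q) + (r + s) ≡ (p + r) + (q + s)
+-interchange p q r s = begin
  (p + q) + (r + s) ≡⟨ +-assoc p q (r + s) ⟩
  p + (q + (r + s)) ≡⟨ ≡.cong (p +_) (+-assoc q r s) ⟨
  p + ((q + r) + s) ≡⟨ ≡.cong (λ x → p + (x + s)) (+-comm q r) ⟩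
  p + ((r + q) + s) ≡⟨ ≡.cong (p +_) (+-assoc r q s) ⟩
  p + (r + (q + s)) ≡⟨ +-assoc p r (q + s) ⟨
  (p + r) + (q + s) ∎
  where open ≡.≡-Reasoning

p≤p+q : ∀ p q → p ≤ p + q
p≤p+q p q = ≡.subst (ℚ._≤ value (p + q)) (ℚ.+-identityʳ (value p))
              (ℚ.+-mono-≤ (ℚ.≤-refl {value p}) (nonNegative q))

q≤p+q : ∀ p q → q ≤ p + q
q≤p+q p q = ≡.subst (λ x → q ≤ x) (+-comm q p) (p≤p+q q p)

0≤ : (r : [0,∞] ℓ) → r ≤ℚ 0# → ∀ ε → r ≤ℚ ε
0≤ r z ε = upper r 0# ε (nonNegative ε) z

⊞-bound : (r s : [0,∞] ℓ) → ∀ p q → r ≤ℚ p → s ≤ℚ q → r ⊞ s ≤ℚ p + q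
⊞-bound r s p q rp sq ε′ lt = p , q , rp , sq , ℚ.<⇒≤ lt

⊞-elim : (r s : [0,∞] ℓ) (t : [0,∞] ℓ′) →
         (∀ p q → r ≤ℚ p → s ≤ℚ q → t ≤ℚ p + q) → t ⊑ r ⊞ s
⊞-elim r s t h ε b = closed t ε λ ε′ ε<ε′ →
  let p , q , rp , sq , p+q≤ε′ = b ε′ ε<ε′ in upper t (p + q) ε′ p+q≤ε′ (h p q rp sq)

⊑-⊞ˡ : (r s : [0,∞] ℓ) → r ⊑ r ⊞ s
⊑-⊞ˡ r s = ⊞-elim r s r λ p q rp _ → upper r p (p + q) (p≤p+q p q) rp

⊑-⊞ʳ : (r s : [0,∞] ℓ) → s ⊑ r ⊞ s
⊑-⊞ʳ r s = ⊞-elim r s s λ p q _ sq → upper s q (p + q) (q≤p+q p q) sq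

-- Truncated subtraction of a rational.
_⊖_ : [0,∞] ℓ → ℚ≥0 → [0,∞] ℓ
t ⊖ q = record
  { Bound = λ p → t ≤ℚ p + q
  ; upper = λ p p′ p≤p′ → upper t (p + q) (p′ + q) (ℚ.+-mono-≤ p≤p′ (ℚ.≤-refl {value q}))
  ; closed = λ p b → closed t (p + q) λ ε p+q<ε →
      let p<ε-q : value p ℚ.< value ε ℚ.- value q
          p<ε-q = ≡.subst (ℚ._< value ε ℚ.- value q) (cancel (value p) (value q))
                    (ℚ.+-monoˡ-< (ℚ.- value q) p+q<ε)
          p′ : ℚ≥0
          p′ = (value ε ℚ.- value q) ,ᵣ [ ℚ.≤-trans (nonNegative p) (ℚ.<⇒≤ p<ε-q) ]
      in ≡.subst (t ≤ℚ_) (value-injective {p′ + q} {ε} (restore (value ε) (value q)))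
           (b p′ p<ε-q)
  }
  where
  cancel : ∀ x y → (x ℚ.+ y) ℚ.- y ≡ x
  cancel x y = ≡.trans (ℚ.+-assoc x y (ℚ.- y))
    (≡.trans (≡.cong (x ℚ.+_) (ℚ.+-inverseʳ y)) (ℚ.+-identityʳ x))
  restore : ∀ x y → (x ℚ.- y) ℚ.+ y ≡ x
  restore x y = ≡.trans (ℚ.+-assoc x (ℚ.- y) y)
    (≡.trans (≡.cong (x ℚ.+_) (ℚ.+-inverseˡ y)) (ℚ.+-identityʳ x))

⊞-elimˡ : (r s u : [0,∞] ℓ) (t : [0,∞] ℓ′) →
          (∀ p q q′ → r ≤ℚ p → s ≤ℚ q → u ≤ℚ q′ → t ≤ℚ (p + q) + q′) →
          t ⊑ (r ⊞ s) ⊞ u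
⊞-elimˡ r s u t h = ⊞-elim (r ⊞ s) u t λ P q′ b uq′ →
  ⊞-elim r s (t ⊖ q′) (λ p q rp sq → h p q q′ rp sq uq′) P b

⊞-elim₄ : (r s r′ s′ : [0,∞] ℓ) (t : [0,∞] ℓ′) →
          (∀ p q p′ q′ → r ≤ℚ p → s ≤ℚ q → r′ ≤ℚ p′ → s′ ≤ℚ q′ →
             t ≤ℚ (p + q) + (p′ + q′)) →
          t ⊑ (r ⊞ s) ⊞ (r′ ⊞ s′)
⊞-elim₄ r s r′ s′ t h = ⊞-elimˡ r s (r′ ⊞ s′) t λ p q Q rp sq b →
  ≡.subst (t ≤ℚ_) (+-comm Q (p + q))
    (⊞-elim r′ s′ (t ⊖ (p + q))
      (λ p′ q′ rp′ sq′ → ≡.subst (t ≤ℚ_) (+-comm (p + q) (p′ + q′))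
                           (h p q p′ q′ rp sq rp′ sq′)) Q b)

------------------------------------------------------------------------
-- Extended metric spaces

-- The underlying set is a setoid; its equality plays the role of = in the
-- axiom d(x,y) = 0 iff x = y, and equality of maps is pointwise.
record MetricSpace (ℓ : Level) : Set (lsuc ℓ) where
  no-eta-equality
  infix 4 _≈_
  field
    Carrier       : Set ℓ
    _≈_           : Rel Carrier ℓ
    isEquivalence : IsEquivalence _≈_
    d             : Carrier → Carrier → [0,∞] ℓ
    d≐0⇒≈         : ∀ x y → d x y ≐ 0∞ {ℓ} → x ≈ y
    ≈⇒d≐0         : ∀ x y → x ≈ y → d x y ≐ 0∞ {ℓ}
    symmetry      : ∀ x y → d x y ≐ d y x
    triangle      : ∀ x y z → d x z ⊑ d x y ⊞ d y z

  setoid : Setoid ℓ ℓ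
  setoid = record { isEquivalence = isEquivalence }

  module Eq = IsEquivalence isEquivalence

  d-refl : ∀ {x y} → x ≈ y → ∀ ε → d x y ≤ℚ ε
  d-refl {x} {y} p ε = proj₁ (≈⇒d≐0 x y p) ε tt

  d-zero : ∀ {x y} → d x y ≤ℚ 0# → x ≈ y
  d-zero {x} {y} z = d≐0⇒≈ x y ((λ ε _ → 0≤ (d x y) z ε) , (λ _ _ → tt))

  d-sym : ∀ {x y ε} → d x y ≤ℚ ε → d y x ≤ℚ ε
  d-sym {x} {y} {ε} = proj₁ (symmetry y x) ε

  d-trans : ∀ {x z} y p q → d x y ≤ℚ p → d y z ≤ℚ q → d x z ≤ℚ p + q
  d-trans {x} {z} y p q b b′ =
    triangle x y z (p + q) (⊞-bound (d x y) (d y z) p q b b′)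

  d-resp : ∀ {x x′ y y′ ε} → x ≈ x′ → y ≈ y′ → d x y ≤ℚ ε → d x′ y′ ≤ℚ ε
  d-resp {x} {x′} {y} {y′} {ε} p q b =
    ≡.subst (d x′ y′ ≤ℚ_) (≡.trans (+-identityˡ _) (+-identityʳ ε))
      (d-trans x 0# (ε + 0#) (d-refl (Eq.sym p) 0#)
        (d-trans y ε 0# b (d-refl q 0#)))

{-# INLINE MetricSpace.constructor #-}

∣_∣ : MetricSpace ℓ → Set ℓ
∣ X ∣ = MetricSpace.Carrier X

record NonExpansive (X Y : MetricSpace ℓ) : Set ℓ where
  no-eta-equality
  private
    module X = MetricSpace X
    module Y = MetricSpace Y
  field
    fun          : X.Carrier → Y.Carrier
    nonExpansive : ∀ x y → Y.d (fun x) (fun y) ⊑ X.d x y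

  fun-cong : ∀ {x y} → x X.≈ y → fun x Y.≈ fun y
  fun-cong {x} {y} p = Y.d-zero (nonExpansive x y 0# (X.d-refl p 0#))

{-# INLINE NonExpansive.constructor #-}

open NonExpansive public using (fun; nonExpansive; fun-cong)

infix  4 _⇒_ _≈_
infixr 9 _∘_

_⇒_ : MetricSpace ℓ → MetricSpace ℓ → Set ℓ
_⇒_ = NonExpansive

_≈_ : {X Y : MetricSpace ℓ} → Rel (X ⇒ Y) ℓ
_≈_ {Y = Y} f g = ∀ x → MetricSpace._≈_ Y (fun f x) (fun g x)

id : {X : MetricSpace ℓ} → X ⇒ X
id = record { fun = λ x → x ; nonExpansive = λ _ _ _ b → b }

_∘_ : {X Y Z : MetricSpace ℓ} → Y ⇒ Z → X ⇒ Y → X ⇒ Z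
g ∘ f = record
  { fun = λ x → fun g (fun f x)
  ; nonExpansive = λ x y ε b →
      nonExpansive g (fun f x) (fun f y) ε (nonExpansive f x y ε b)
  }

Met : (ℓ : Level) → Category (lsuc ℓ) ℓ ℓ
Met ℓ = record
  { Obj = MetricSpace ℓ
  ; _⇒_ = _⇒_
  ; _≈_ = _≈_
  ; id = id
  ; _∘_ = _∘_
  ; isEquivalence = λ {X} {Y} → let open MetricSpace.Eq Y in record
    { refl = λ _ → refl ; sym = λ p x → sym (p x) ; trans = λ p q x → trans (p x) (q x) }
  ; ∘-resp-≈ = λ {A} {B} {C} {f} {h} {g} {i} p q x →
      MetricSpace.Eq.trans C (p (fun g x)) (fun-cong h (q x))
  ; identityˡ = λ {A} {B} _ → MetricSpace.Eq.refl B
  ; identityʳ = λ {A} {B} _ → MetricSpace.Eq.refl B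
  ; assoc = λ {A} {B} {C} {D} _ → MetricSpace.Eq.refl D
  }

𝟙 : MetricSpace ℓ
𝟙 = record
  { Carrier = ⊤
  ; _≈_ = λ _ _ → ⊤
  ; isEquivalence = record { refl = tt ; sym = λ _ → tt ; trans = λ _ _ → tt }
  ; d = λ _ _ → 0∞
  ; d≐0⇒≈ = λ _ _ _ → tt
  ; ≈⇒d≐0 = λ _ _ _ → (λ _ _ → tt) , (λ _ _ → tt)
  ; symmetry = λ _ _ → (λ _ _ → tt) , (λ _ _ → tt)
  ; triangle = λ _ _ _ _ _ → tt
  }

infixr 7 _□_ _□₁_

_□_ : MetricSpace ℓ → MetricSpace ℓ → MetricSpace ℓ
X □ Y = record
  { Carrier = X.Carrier × Y.Carrier
  ; _≈_ = λ (x , y) (x′ , y′) → x X.≈ x′ × y Y.≈ y′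
  ; isEquivalence = record
    { refl = X.Eq.refl , Y.Eq.refl
    ; sym = λ (p , q) → X.Eq.sym p , Y.Eq.sym q
    ; trans = λ (p , q) (p′ , q′) → X.Eq.trans p p′ , Y.Eq.trans q q′
    }
  ; d = D
  ; d≐0⇒≈ = λ (x , y) (x′ , y′) (z , _) →
        X.d-zero (⊑-⊞ˡ (X.d x x′) (Y.d y y′) 0# (z 0# tt))
      , Y.d-zero (⊑-⊞ʳ (X.d x x′) (Y.d y y′) 0# (z 0# tt))
  ; ≈⇒d≐0 = λ (x , y) (x′ , y′) (p , q) →
        (λ ε _ → 0≤ (X.d x x′ ⊞ Y.d y y′)
          (⊞-bound (X.d x x′) (Y.d y y′) 0# 0# (X.d-refl p 0#) (Y.d-refl q 0#)) ε)
      , (λ _ _ → tt)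
  ; symmetry = λ a b → swap b a , swap a b
  ; triangle = λ (x , y) (x′ , y′) (x″ , y″) →
      ⊞-elim₄ (X.d x x′) (Y.d y y′) (X.d x′ x″) (Y.d y′ y″) (X.d x x″ ⊞ Y.d y y″)
        λ p q p′ q′ b c b′ c′ →
          ≡.subst (X.d x x″ ⊞ Y.d y y″ ≤ℚ_) (+-interchange p p′ q q′)
            (⊞-bound (X.d x x″) (Y.d y y″) (p + p′) (q + q′)
              (X.d-trans x′ p p′ b b′) (Y.d-trans y′ q q′ c c′))
  }
  where
  module X = MetricSpace X
  module Y = MetricSpace Y
  D : X.Carrier × Y.Carrier → X.Carrier × Y.Carrier → [0,∞] _
  D (x , y) (x′ , y′) = X.d x x′ ⊞ Y.d y y′
  swap : ∀ a b → D b a ⊑ D a b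
  swap (x , y) (x′ , y′) = ⊞-elim (X.d x x′) (Y.d y y′) (X.d x′ x ⊞ Y.d y′ y)
    λ p q b c → ⊞-bound (X.d x′ x) (Y.d y′ y) p q (X.d-sym b) (Y.d-sym c)

_□₁_ : {X X′ Y Y′ : MetricSpace ℓ} → X ⇒ X′ → Y ⇒ Y′ → X □ Y ⇒ X′ □ Y′
_□₁_ {X = X} {X′} {Y} {Y′} f g = record
  { fun = λ (x , y) → fun f x , fun g y
  ; nonExpansive = λ (x , y) (x′ , y′) → 
      ⊞-elim (X.d x x′) (Y.d y y′)
        (X′.d (fun f x) (fun f x′) ⊞ Y′.d (fun g y) (fun g y′)) λ p q b c →
          ⊞-bound (X′.d (fun f x) (fun f x′)) (Y′.d (fun g y) (fun g y′)) p q
            (nonExpansive f x x′ p b) (nonExpansive g y y′ q c)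
  }
  where
  module X = MetricSpace X
  module Y = MetricSpace Y
  module X′ = MetricSpace X′
  module Y′ = MetricSpace Y′

unitor : (Y : MetricSpace ℓ) → 𝟙 □ Y ⇒ Y
unitor Y = record
  { fun = proj₂
  ; nonExpansive = λ (_ , y) (_ , y′) → ⊑-⊞ʳ 0∞ (MetricSpace.d Y y y′)
  }

associator : (X Y Z : MetricSpace ℓ) → (X □ Y) □ Z ⇒ X □ (Y □ Z)
associator X Y Z = record
  { fun = λ ((x , y) , z) → x , (y , z)
  ; nonExpansive = λ ((x , y) , z) ((x′ , y′) , z′) →
      ⊞-elimˡ (X.d x x′) (Y.d y y′) (Z.d z z′) (X.d x x′ ⊞ (Y.d y y′ ⊞ Z.d z z′))
        λ p q r b c e → ≡.subst (X.d x x′ ⊞ (Y.d y y′ ⊞ Z.d z z′) ≤ℚ_)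
          (≡.sym (+-assoc p q r))
          (⊞-bound (X.d x x′) (Y.d y y′ ⊞ Z.d z z′) p (q + r) b
            (⊞-bound (Y.d y y′) (Z.d z z′) q r c e))
  }
  where
  module X = MetricSpace X
  module Y = MetricSpace Y
  module Z = MetricSpace Z

infixr 8 _⟶_

_⟶_ : MetricSpace ℓ → MetricSpace ℓ → MetricSpace ℓ
X ⟶ Y = record
  { Carrier = X ⇒ Y
  ; _≈_ = λ f g → f ≈ g
  ; isEquivalence = Category.isEquivalence (Met _) {X} {Y}
  ; d = λ f g → sup (λ x → Y.d (fun f x) (fun g x))
  ; d≐0⇒≈ = λ f g (z , _) x → Y.d-zero (z 0# tt x)
  ; ≈⇒d≐0 = λ f g p → (λ ε _ x → Y.d-refl (p x) ε) , (λ _ _ → tt)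
  ; symmetry = λ f g → (λ ε b x → Y.d-sym (b x)) , (λ ε b x → Y.d-sym (b x))
  ; triangle = λ f g h → ⊞-elim
      (sup λ x → Y.d (fun f x) (fun g x)) (sup λ x → Y.d (fun g x) (fun h x))
      (sup λ x → Y.d (fun f x) (fun h x))
      λ p q b c x → Y.d-trans (fun g x) p q (b x) (c x)
  }
  where module Y = MetricSpace Y

infix 8 _^_

-- The power carrying the max metric.
_^_ : MetricSpace ℓ → ℕ → MetricSpace ℓ
A ^ n = record
  { Carrier = Fin n → A.Carrier
  ; _≈_ = λ x y → ∀ i → x i A.≈ y i
  ; isEquivalence = record
    { refl = λ _ → A.Eq.refl
    ; sym = λ p i → A.Eq.sym (p i)
    ; trans = λ p q i → A.Eq.trans (p i) (q i)
    }
  ; d = λ x y → sup (λ i → A.d (x i) (y i))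
  ; d≐0⇒≈ = λ x y (z , _) i → A.d-zero (z 0# tt i)
  ; ≈⇒d≐0 = λ x y p → (λ ε _ i → A.d-refl (p i) ε) , (λ _ _ → tt)
  ; symmetry = λ x y → (λ ε b i → A.d-sym (b i)) , (λ ε b i → A.d-sym (b i))
  ; triangle = λ x y z → ⊞-elim
      (sup λ i → A.d (x i) (y i)) (sup λ i → A.d (y i) (z i)) (sup λ i → A.d (x i) (z i))
      λ p q b c i → A.d-trans (y i) p q (b i) (c i)
  }
  where module A = MetricSpace A

------------------------------------------------------------------------
-- Strength

Endofunctor : (ℓ : Level) → Set (lsuc ℓ)
Endofunctor ℓ = Functor (Met ℓ) (Met ℓ)

record Strength (F : Endofunctor ℓ) : Set (lsuc ℓ) where
  open Functor F
  field
    t         : ∀ X Y → X □ F₀ Y ⇒ F₀ (X □ Y)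
    natural   : ∀ {X X′ Y Y′} (f : X ⇒ X′) (g : Y ⇒ Y′) →
                F₁ (f □₁ g) ∘ t X Y ≈ t X′ Y′ ∘ (f □₁ F₁ g)
    t-unit    : ∀ Y → F₁ (unitor Y) ∘ t 𝟙 Y ≈ unitor (F₀ Y)
    t-assoc   : ∀ X Y Z → F₁ (associator X Y Z) ∘ t (X □ Y) Z ≈
                t X (Y □ Z) ∘ (id {X = X} □₁ t Y Z) ∘ associator X Y (F₀ Z)

IsStrongTransformation : {F G : Endofunctor ℓ} → Strength F → Strength G →
                         NaturalTransformation F G → Set (lsuc ℓ)
IsStrongTransformation s t α =
  ∀ X Y → α.η (X □ Y) ∘ s.t X Y ≈ t.t X Y ∘ (id {X = X} □₁ α.η Y)
  where
  module α = NaturalTransformation α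
  module s = Strength s
  module t = Strength t

-- x ↦ (y ↦ (x , y))
pair : (X Y : MetricSpace ℓ) → ∣ X ∣ → Y ⇒ X □ Y
pair X Y x = record
  { fun = λ y → x , y
  ; nonExpansive = λ y y′ ε b → ≡.subst (X.d x x ⊞ Y.d y y′ ≤ℚ_) (+-identityˡ ε)
      (⊞-bound (X.d x x) (Y.d y y′) 0# ε (X.d-refl X.Eq.refl 0#) b)
  }
  where
  module X = MetricSpace X
  module Y = MetricSpace Y

IsEnriched : Endofunctor ℓ → Set (lsuc ℓ)
IsEnriched F = ∀ {X Y} (f g : X ⇒ Y) u →
  MetricSpace.d (F₀ Y) (fun (F₁ f) u) (fun (F₁ g) u) ⊑ MetricSpace.d (X ⟶ Y) f g
  where open Functor F

module _ {ℓ : Level} (F : Endofunctor ℓ) (enriched : IsEnriched F) where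

  open Functor F

  -- The strength (x , u) ↦ F (y ↦ (x , y)) u.
  pairing-strength : Strength F
  pairing-strength = record
    { t = t
    ; natural = λ {X} {X′} {Y} {Y′} f g (x , u) → F-square
        (f □₁ g) (pair X Y x) (pair X′ Y′ (fun f x)) g
        (λ _ → MetricSpace.Eq.refl X′ , MetricSpace.Eq.refl Y′) u
    ; t-unit = λ Y (x , u) → let open MetricSpace.Eq (F₀ Y) in
        trans (sym (homomorphism {f = pair 𝟙 Y x} {g = unitor Y} u))
          (trans (F-resp-≈ {X = Y} {Y = Y} {f = unitor Y ∘ pair 𝟙 Y x} {g = id}
                   (λ _ → MetricSpace.Eq.refl Y) u)
            (identity {X = Y} u))
    ; t-assoc = λ X Y Z ((x , y) , u) → F-square
        (associator X Y Z) (pair (X □ Y) Z (x , y)) (pair X (Y □ Z) x) (pair Y Z y)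
        (λ _ → MetricSpace.Eq.refl X , MetricSpace.Eq.refl Y , MetricSpace.Eq.refl Z) u
    }
    where
    F-square : ∀ {W X Y Z} (f : X ⇒ Z) (g : W ⇒ X) (h : Y ⇒ Z) (i : W ⇒ Y) →
               f ∘ g ≈ h ∘ i → F₁ f ∘ F₁ g ≈ F₁ h ∘ F₁ i
    F-square {Z = Z} f g h i p u = let open MetricSpace.Eq (F₀ Z) in
      trans (sym (homomorphism {f = g} {g = f} u))
        (trans (F-resp-≈ {f = f ∘ g} {g = h ∘ i} p u) (homomorphism {f = i} {g = h} u))

    t : ∀ X Y → X □ F₀ Y ⇒ F₀ (X □ Y)
    t X Y = record
      { fun = λ (x , u) → fun (F₁ (pair X Y x)) u
      ; nonExpansive = λ (x , u) (x′ , u′) →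
          ⊞-elim (MetricSpace.d X x x′) (MetricSpace.d (F₀ Y) u u′)
            (MetricSpace.d (F₀ (X □ Y)) (fun (F₁ (pair X Y x)) u) (fun (F₁ (pair X Y x′)) u′))
            λ p q b c → MetricSpace.d-trans (F₀ (X □ Y)) (fun (F₁ (pair X Y x′)) u) p q
              (enriched (pair X Y x) (pair X Y x′) u p λ y →
                ≡.subst (MetricSpace.d X x x′ ⊞ MetricSpace.d Y y y ≤ℚ_) (+-identityʳ p)
                  (⊞-bound (MetricSpace.d X x x′) (MetricSpace.d Y y y) p 0# b
                    (MetricSpace.d-refl Y (MetricSpace.Eq.refl Y) 0#)))
              (nonExpansive (F₁ (pair X Y x′)) u u′ q c)
      }

-- The strength is forced to be (x , u) ↦ F (y ↦ (x , y)) u.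
strength-unique : {F : Endofunctor ℓ} (s : Strength F) → ∀ X Y (x : ∣ X ∣) u →
  MetricSpace._≈_ (Functor.F₀ F (X □ Y))
    (fun (Strength.t s X Y) (x , u)) (fun (Functor.F₁ F (pair X Y x)) u)
strength-unique {F = F} s X Y x u = begin
  fun (t X Y) (x , u)                                    ≈⟨ fun-cong (t X Y) (X.Eq.refl , identity {Y} u) ⟨
  fun (t X Y) (x , fun (F₁ {Y} id) u)                    ≈⟨ natural {Y = Y} point id (tt , u) ⟨
  fun (F₁ (point □₁ id)) (fun (t 𝟙 Y) (tt , u))          ≈⟨ F-resp-≈ {g = pair X Y x ∘ unitor Y}
                                                              (λ _ → X.Eq.refl , Y.Eq.refl) _ ⟩
  fun (F₁ (pair X Y x ∘ unitor Y)) (fun (t 𝟙 Y) (tt , u)) ≈⟨ homomorphism {f = unitor Y} {g = pair X Y x} _ ⟩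
  fun (F₁ (pair X Y x)) (fun (F₁ (unitor Y)) (fun (t 𝟙 Y) (tt , u)))
                                                         ≈⟨ fun-cong (F₁ (pair X Y x)) (t-unit Y (tt , u)) ⟩
  fun (F₁ (pair X Y x)) u                                ∎
  where
  open Functor F
  open Strength s
  module X = MetricSpace X
  module Y = MetricSpace Y
  open SetoidReasoning (MetricSpace.setoid (F₀ (X □ Y)))
  point : 𝟙 ⇒ X
  point = record { fun = λ _ → x ; nonExpansive = λ _ _ ε _ → X.d-refl X.Eq.refl ε }

record StrongMonad (ℓ : Level) : Set (lsuc ℓ) where
  field
    monad    : Monad (Met ℓ)
    strength : Strength (Monad.T monad)
  open Monad monad public
  open Strength strength public using (t)
  field
    η-strong : ∀ X Y → η.η (X □ Y) ≈ t X Y ∘ (id {X = X} □₁ η.η Y)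
    μ-strong : ∀ X Y → μ.η (X □ Y) ∘ T.F₁ (t X Y) ∘ t X (T.F₀ Y) ≈
                       t X Y ∘ (id {X = X} □₁ μ.η Y)

exponent : MetricSpace ℓ → Endofunctor ℓ
exponent v = record
  { F₀ = v ⟶_
  ; F₁ = λ {X} {Y} f → record
    { fun = λ φ → f ∘ φ
    ; nonExpansive = λ φ ψ ε b p → nonExpansive f (fun φ p) (fun ψ p) ε (b p)
    }
  ; F-resp-≈ = λ f≈g φ p → f≈g (fun φ p)
  ; identity = λ {X} φ p → MetricSpace.Eq.refl X
  ; homomorphism = λ {X} {Y} {Z} φ p → MetricSpace.Eq.refl Z
  }

exponent-strength : (v : MetricSpace ℓ) → Strength (exponent v)
exponent-strength v = pairing-strength (exponent v) λ f g φ ε b p → b (fun φ p)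

record PreOperation (v : MetricSpace ℓ) {F : Endofunctor ℓ} (s : Strength F) : Set (lsuc ℓ) where
  field
    transformation : NaturalTransformation (exponent v) F
    isStrong       : IsStrongTransformation (exponent-strength v) s transformation
  open NaturalTransformation transformation public

ev : (v A : MetricSpace ℓ) → v □ (v ⟶ A) ⇒ A
ev v A = record
  { fun = λ (p , φ) → fun φ p
  ; nonExpansive = λ (p , φ) (q , ψ) → ⊞-elim
      (MetricSpace.d v p q) (MetricSpace.d (v ⟶ A) φ ψ) (MetricSpace.d A (fun φ p) (fun ψ q))
      λ r s b c → MetricSpace.d-trans A (fun φ q) r s (nonExpansive φ p q r b) (c q)
  }

evAt : (v A : MetricSpace ℓ) → ∣ v ∣ → (v ⟶ A) ⇒ A
evAt v A p = record { fun = λ φ → fun φ p ; nonExpansive = λ φ ψ ε b → b p }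

-- ā(u)(p) = a(F(ev_p)(u)); the strength of F makes this non-expansive in p.
power : {F : Endofunctor ℓ} → Strength F → (v : MetricSpace ℓ) {A : MetricSpace ℓ} →
        Functor.F₀ F A ⇒ A → Functor.F₀ F (v ⟶ A) ⇒ (v ⟶ A)
power {F = F} s v {A} a = record
  { fun = λ u → record
    { fun = λ p → fun a (fun (F₁ (evAt v A p)) u)
    ; nonExpansive = λ p q ε b →
        MetricSpace.d-resp A (fun-cong a (F-ev p u)) (fun-cong a (F-ev q u))
          (nonExpansive (a ∘ F₁ (ev v A) ∘ Strength.t s v (v ⟶ A)) (p , u) (q , u) ε
            (≡.subst (MetricSpace.d v p q ⊞ MetricSpace.d (F₀ (v ⟶ A)) u u ≤ℚ_) (+-identityʳ ε)
              (⊞-bound (MetricSpace.d v p q) (MetricSpace.d (F₀ (v ⟶ A)) u u) ε 0# b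
                (MetricSpace.d-refl (F₀ (v ⟶ A)) (MetricSpace.Eq.refl (F₀ (v ⟶ A))) 0#))))
    }
  ; nonExpansive = λ u u′ ε b p → nonExpansive (a ∘ F₁ (evAt v A p)) u u′ ε b
  }
  where
  open Functor F
  F-ev : ∀ p u → MetricSpace._≈_ (F₀ A)
           (fun (F₁ (ev v A)) (fun (Strength.t s v (v ⟶ A)) (p , u)))
           (fun (F₁ (evAt v A p)) u)
  F-ev p u = let open MetricSpace.Eq (F₀ A) in
    trans (fun-cong (F₁ (ev v A)) (strength-unique s v (v ⟶ A) p u))
      (trans (sym (homomorphism {f = pair v (v ⟶ A) p} {g = ev v A} u))
        (F-resp-≈ {f = ev v A ∘ pair v (v ⟶ A) p} {g = evAt v A p}
          (λ _ → MetricSpace.Eq.refl A) u))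

------------------------------------------------------------------------
-- The tensor of strong monads

record IsEilenbergMoore (M : Monad (Met ℓ)) {A : MetricSpace ℓ}
       (a : Functor.F₀ (Monad.T M) A ⇒ A) : Set ℓ where
  open Monad M
  field
    unit : a ∘ η.η A ≈ id
    mult : a ∘ T.F₁ a ≈ a ∘ μ.η A

IsHomomorphism : (F : Endofunctor ℓ) {A B : MetricSpace ℓ} →
                 Functor.F₀ F A ⇒ A → Functor.F₀ F B ⇒ B → A ⇒ B → Set ℓ
IsHomomorphism F a b h = h ∘ a ≈ b ∘ Functor.F₁ F h

module _ (S T : StrongMonad ℓ) where

  private
    module S = StrongMonad S
    module T = StrongMonad T

  record TensorAlgebra : Set (lsuc ℓ) where
    field
      space : MetricSpace ℓ
      a     : S.T.F₀ space ⇒ space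
      b     : T.T.F₀ space ⇒ space
      a-isEilenbergMoore : IsEilenbergMoore S.monad a
      b-isEilenbergMoore : IsEilenbergMoore T.monad b
      tensor : ∀ (v : MetricSpace ℓ) (g : PreOperation v S.strength) →
               IsHomomorphism T.T (power T.strength v b) b (a ∘ PreOperation.η g space)

  record TensorHomomorphism (A B : TensorAlgebra) : Set ℓ where
    private
      module A = TensorAlgebra A
      module B = TensorAlgebra B
    field
      hom   : A.space ⇒ B.space
      hom-a : IsHomomorphism S.T A.a B.a hom
      hom-b : IsHomomorphism T.T A.b B.b hom

  open TensorHomomorphism

  TensorAlgebras : Category (lsuc ℓ) ℓ ℓ
  TensorAlgebras = record
    { Obj = TensorAlgebra
    ; _⇒_ = TensorHomomorphism
    ; _≈_ = λ f g → hom f ≈ hom g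
    ; id = λ {A} → record
      { hom = id
      ; hom-a = hom-id S.T (TensorAlgebra.a A)
      ; hom-b = hom-id T.T (TensorAlgebra.b A)
      }
    ; _∘_ = λ {A} {B} {C} g f → record
      { hom = hom g ∘ hom f
      ; hom-a = hom-∘ S.T {a = TensorAlgebra.a A} {TensorAlgebra.a B} {TensorAlgebra.a C}
                  (hom g) (hom f) (hom-a g) (hom-a f)
      ; hom-b = hom-∘ T.T {a = TensorAlgebra.b A} {TensorAlgebra.b B} {TensorAlgebra.b C}
                  (hom g) (hom f) (hom-b g) (hom-b f)
      }
    ; isEquivalence = λ {A} {B} →
        let open MetricSpace.Eq (TensorAlgebra.space B) in record
        { refl = λ _ → refl ; sym = λ p x → sym (p x) ; trans = λ p q x → trans (p x) (q x) }
    ; ∘-resp-≈ = λ {A} {B} {C} {f} {h} {g} {i} p q x →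
        MetricSpace.Eq.trans (TensorAlgebra.space C)
          (p (fun (hom g) x)) (fun-cong (hom h) (q x))
    ; identityˡ = λ {A} {B} _ → MetricSpace.Eq.refl (TensorAlgebra.space B)
    ; identityʳ = λ {A} {B} _ → MetricSpace.Eq.refl (TensorAlgebra.space B)
    ; assoc = λ {A} {B} {C} {D} _ → MetricSpace.Eq.refl (TensorAlgebra.space D)
    }
    where
    hom-id : (F : Endofunctor ℓ) {X : MetricSpace ℓ} (c : Functor.F₀ F X ⇒ X) →
             IsHomomorphism F c c id
    hom-id F {X} c u = MetricSpace.Eq.sym X (fun-cong c (Functor.identity F {X} u))
    hom-∘ : (F : Endofunctor ℓ) {X Y Z : MetricSpace ℓ} {a : Functor.F₀ F X ⇒ X}
            {b : Functor.F₀ F Y ⇒ Y} {c : Functor.F₀ F Z ⇒ Z} (g : Y ⇒ Z) (f : X ⇒ Y) →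
            IsHomomorphism F b c g → IsHomomorphism F a b f → IsHomomorphism F a c (g ∘ f)
    hom-∘ F {Z = Z} {c = c} g f hg hf u = let open MetricSpace.Eq Z in
      trans (fun-cong g (hf u))
        (trans (hg (fun (Functor.F₁ F f) u))
          (fun-cong c (MetricSpace.Eq.sym (Functor.F₀ F Z)
            (Functor.homomorphism F {f = f} {g = g} u))))

  forgetTensor : Functor TensorAlgebras (Met ℓ)
  forgetTensor = record
    { F₀ = TensorAlgebra.space
    ; F₁ = hom
    ; F-resp-≈ = λ p → p
    ; identity = λ {A} _ → MetricSpace.Eq.refl (TensorAlgebra.space A)
    ; homomorphism = λ {A} {B} {C} _ → MetricSpace.Eq.refl (TensorAlgebra.space C)
    }

  IsTensor : Monad (Met ℓ) → Set (lsuc ℓ)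
  IsTensor M = ∃[ L ] MonadIso (inducedMonad {G = forgetTensor} L) M

------------------------------------------------------------------------
-- Quantitative equational theories

record Signature (ℓ : Level) : Set (lsuc ℓ) where
  field
    Op    : Set ℓ
    arity : Op → ℕ

open Signature

-- Argument tuples are functions out of Fin n. Terms with pointwise equal
-- arguments are at distance 0 in every theory, by congruence.
data Term (Σ : Signature ℓ) (X : Set ℓ′) : Set (ℓ ⊔ ℓ′) where
  var : X → Term Σ X
  op  : (f : Op Σ) → (Fin (arity Σ f) → Term Σ X) → Term Σ X

eval : {Σ : Signature ℓ} {X : Set ℓ′} {A : Set o} →
       ((f : Op Σ) → (Fin (arity Σ f) → A) → A) → (X → A) → Term Σ X → A
eval i ι (var x)   = ι x
eval i ι (op f ts) = i f (λ k → eval i ι (ts k))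

infix 5 _=[_]_

record Equation (Σ : Signature ℓ) : Set ℓ where
  constructor _=[_]_
  field
    lhs : Term Σ ℕ
    tol : ℚ≥0
    rhs : Term Σ ℕ

mapEq : {Σ : Signature ℓ} {Σ′ : Signature ℓ′} →
        (Term Σ ℕ → Term Σ′ ℕ) → Equation Σ → Equation Σ′
mapEq h (t =[ ε ] s) = h t =[ ε ] h s

_[_] : {Σ : Signature ℓ} → Term Σ ℕ → (ℕ → Term Σ ℕ) → Term Σ ℕ
t [ σ ] = eval op σ t

-- A set of conditional quantitative equations Γ ⊢ φ; the finite set Γ is
-- represented by a list enumerating it.
Judgements : Signature ℓ → Set (lsuc ℓ)
Judgements {ℓ} Σ = List (Equation Σ) → Equation Σ → Set ℓ

infix 4 _⊆_

_⊆_ : {Σ : Signature ℓ} → Judgements Σ → Judgements Σ → Set ℓ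
A ⊆ B = ∀ Γ φ → A Γ φ → B Γ φ

record IsTheory {Σ : Signature ℓ} (_⊢_ : Judgements Σ) : Set ℓ where
  field
    reflexivity  : ∀ x → [] ⊢ (var x =[ 0# ] var x)
    symmetry     : ∀ x y ε → ((var x =[ ε ] var y) ∷ []) ⊢ (var y =[ ε ] var x)
    triangle     : ∀ x y z ε ε′ →
                   ((var x =[ ε ] var z) ∷ (var z =[ ε′ ] var y) ∷ []) ⊢
                   (var x =[ ε + ε′ ] var y)
    weakening    : ∀ x y ε ε′ → 0# < ε′ →
                   ((var x =[ ε ] var y) ∷ []) ⊢ (var x =[ ε + ε′ ] var y)
    congruence   : ∀ f (x y : Fin (arity Σ f) → ℕ) ε →
                   tabulate (λ i → var (x i) =[ ε ] var (y i)) ⊢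
                   (op f (λ i → var (x i)) =[ ε ] op f (λ i → var (y i)))
    continuity   : ∀ Γ t s ε → (∀ ε′ → ε < ε′ → Γ ⊢ (t =[ ε′ ] s)) →
                   Γ ⊢ (t =[ ε ] s)
    substitution : ∀ Γ φ (σ : ℕ → Term Σ ℕ) → Γ ⊢ φ →
                   map (mapEq (_[ σ ])) Γ ⊢ mapEq (_[ σ ]) φ
    assumption   : ∀ Γ φ → φ ∈ Γ → Γ ⊢ φ
    cut          : ∀ Γ Θ ψ → (∀ φ → φ ∈ Θ → Γ ⊢ φ) → Θ ⊢ ψ → Γ ⊢ ψ

record Theory (Σ : Signature ℓ) : Set (lsuc ℓ) where
  field
    _⊢_      : Judgements Σ
    isTheory : IsTheory _⊢_

Axiomatizes : {Σ : Signature ℓ} → Judgements Σ → Theory Σ → Set (lsuc ℓ)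
Axiomatizes {Σ = Σ} A U =
  A ⊆ Theory._⊢_ U × ((W : Theory Σ) → A ⊆ Theory._⊢_ W → Theory._⊢_ U ⊆ Theory._⊢_ W)

IsBasicSet : {Σ : Signature ℓ} → Judgements Σ → Set ℓ
IsBasicSet A = ∀ Γ φ → A Γ φ → ∀ ψ → ψ ∈ Γ →
  ∃[ x ] ∃[ y ] ∃[ ε ] ψ ≡ (var x =[ ε ] var y)

IsBasic : {Σ : Signature ℓ} → Theory Σ → Set (lsuc ℓ)
IsBasic U = ∃[ A ] (IsBasicSet A × Axiomatizes A U)

data Generated {Σ : Signature ℓ} (A : Judgements Σ) : Judgements Σ where
  axiom        : ∀ Γ φ → A Γ φ → Generated A Γ φ
  reflexivity  : ∀ x → Generated A [] (var x =[ 0# ] var x)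
  symmetry     : ∀ x y ε → Generated A ((var x =[ ε ] var y) ∷ []) (var y =[ ε ] var x)
  triangle     : ∀ x y z ε ε′ →
                 Generated A ((var x =[ ε ] var z) ∷ (var z =[ ε′ ] var y) ∷ [])
                             (var x =[ ε + ε′ ] var y)
  weakening    : ∀ x y ε ε′ → 0# < ε′ →
                 Generated A ((var x =[ ε ] var y) ∷ []) (var x =[ ε + ε′ ] var y)
  congruence   : ∀ f (x y : Fin (arity Σ f) → ℕ) ε →
                 Generated A (tabulate (λ i → var (x i) =[ ε ] var (y i)))
                             (op f (λ i → var (x i)) =[ ε ] op f (λ i → var (y i)))
  continuity   : ∀ Γ t s ε → (∀ ε′ → ε < ε′ → Generated A Γ (t =[ ε′ ] s)) →
                 Generated A Γ (t =[ ε ] s)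
  substitution : ∀ Γ φ (σ : ℕ → Term Σ ℕ) → Generated A Γ φ →
                 Generated A (map (mapEq (_[ σ ])) Γ) (mapEq (_[ σ ]) φ)
  assumption   : ∀ Γ φ → φ ∈ Γ → Generated A Γ φ
  cut          : ∀ Γ Θ ψ → (∀ φ → φ ∈ Θ → Generated A Γ φ) →
                 Generated A Θ ψ → Generated A Γ ψ

generated : {Σ : Signature ℓ} → Judgements Σ → Theory Σ
generated A = record
  { _⊢_ = Generated A
  ; isTheory = record
    { reflexivity = reflexivity ; symmetry = symmetry ; triangle = triangle
    ; weakening = weakening ; congruence = congruence ; continuity = continuity
    ; substitution = substitution ; assumption = assumption ; cut = cut
    }
  }

generated-smallest : {Σ : Signature ℓ} (A : Judgements Σ) → Axiomatizes A (generated A)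
generated-smallest {Σ = Σ} A = axiom , least
  where
  least : (W : Theory Σ) → A ⊆ Theory._⊢_ W → Generated A ⊆ Theory._⊢_ W
  least W A⊆W = go
    where
    module W = IsTheory (Theory.isTheory W)
    go : Generated A ⊆ Theory._⊢_ W
    go Γ φ (axiom _ _ h) = A⊆W Γ φ h
    go _ _ (reflexivity x) = W.reflexivity x
    go _ _ (symmetry x y ε) = W.symmetry x y ε
    go _ _ (triangle x y z ε ε′) = W.triangle x y z ε ε′
    go _ _ (weakening x y ε ε′ lt) = W.weakening x y ε ε′ lt
    go _ _ (congruence f x y ε) = W.congruence f x y ε
    go Γ _ (continuity _ t s ε h) = W.continuity Γ t s ε (λ ε′ lt → go Γ _ (h ε′ lt))
    go _ _ (substitution Γ φ σ h) = W.substitution Γ φ σ (go Γ φ h)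
    go Γ φ (assumption _ _ m) = W.assumption Γ φ m
    go Γ ψ (cut _ Θ _ h k) = W.cut Γ Θ ψ (λ φ m → go Γ φ (h φ m)) (go Θ ψ k)

infixr 6 _⊕_

_⊕_ : Signature ℓ → Signature ℓ → Signature ℓ
Σ ⊕ Σ′ = record { Op = Op Σ ⊎ Op Σ′ ; arity = either (arity Σ) (arity Σ′) }

module _ {Σ Σ′ : Signature ℓ} where

  injˡ : Term Σ ℕ → Term (Σ ⊕ Σ′) ℕ
  injˡ = eval (λ f → op (inj₁ f)) var

  injʳ : Term Σ′ ℕ → Term (Σ ⊕ Σ′) ℕ
  injʳ = eval (λ f → op (inj₂ f)) var

  data TensorAxioms (U : Theory Σ) (U′ : Theory Σ′) : Judgements (Σ ⊕ Σ′) where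
    left  : ∀ Γ φ → Theory._⊢_ U Γ φ →
            TensorAxioms U U′ (map (mapEq injˡ) Γ) (mapEq injˡ φ)
    right : ∀ Γ φ → Theory._⊢_ U′ Γ φ →
            TensorAxioms U U′ (map (mapEq injʳ) Γ) (mapEq injʳ φ)
    commutation : ∀ f g (x : Fin (arity Σ f) → Fin (arity Σ′ g) → ℕ) →
      TensorAxioms U U′ []
        (op (inj₁ f) (λ i → op (inj₂ g) (λ j → var (x i j)))
          =[ 0# ]
         op (inj₂ g) (λ j → op (inj₁ f) (λ i → var (x i j))))

  infixr 7 _⊗_

  _⊗_ : Theory Σ → Theory Σ′ → Theory (Σ ⊕ Σ′)
  U ⊗ U′ = generated (TensorAxioms U U′)

------------------------------------------------------------------------
-- Quantitative algebras

record QuantitativeAlgebra (Σ : Signature ℓ) : Set (lsuc ℓ) where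
  field
    space  : MetricSpace ℓ
    interp : (f : Op Σ) → space ^ arity Σ f ⇒ space
  open MetricSpace space public

  ⟦_⟧ : {X : Set ℓ′} → Term Σ X → (X → Carrier) → Carrier
  ⟦ t ⟧ ι = eval (λ f → fun (interp f)) ι t

  _⊨_ : (ℕ → Carrier) → Equation Σ → Set ℓ
  ι ⊨ (t =[ ε ] s) = d (⟦ t ⟧ ι) (⟦ s ⟧ ι) ≤ℚ ε

  Satisfies : List (Equation Σ) → Equation Σ → Set ℓ
  Satisfies Γ φ = ∀ ι → (∀ ψ → ψ ∈ Γ → ι ⊨ ψ) → ι ⊨ φ

module _ {Σ : Signature ℓ} (U : Theory Σ) where

  open Theory U using (_⊢_)

  record Model : Set (lsuc ℓ) where
    field
      algebra   : QuantitativeAlgebra Σ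
      satisfies : ∀ Γ φ → Γ ⊢ φ → QuantitativeAlgebra.Satisfies algebra Γ φ
    open QuantitativeAlgebra algebra public

  record ModelHomomorphism (A B : Model) : Set ℓ where
    private
      module A = Model A
      module B = Model B
    field
      hom    : A.space ⇒ B.space
      hom-op : ∀ f (x : Fin (arity Σ f) → A.Carrier) →
               fun hom (fun (A.interp f) x) B.≈ fun (B.interp f) (λ i → fun hom (x i))

  open ModelHomomorphism

  𝕂 : Category (lsuc ℓ) ℓ ℓ
  𝕂 = record
    { Obj = Model
    ; _⇒_ = ModelHomomorphism
    ; _≈_ = λ f g → hom f ≈ hom g
    ; id = λ {A} → record { hom = id ; hom-op = λ _ _ → Model.Eq.refl A }
    ; _∘_ = λ {A} {B} {C} g f → record
      { hom = hom g ∘ hom f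
      ; hom-op = λ k x → Model.Eq.trans C (fun-cong (hom g) (hom-op f k x)) (hom-op g k _)
      }
    ; isEquivalence = λ {A} {B} → let open Model.Eq B in record
      { refl = λ _ → refl ; sym = λ p x → sym (p x) ; trans = λ p q x → trans (p x) (q x) }
    ; ∘-resp-≈ = λ {A} {B} {C} {f} {h} {g} {i} p q x →
        Model.Eq.trans C (p (fun (hom g) x)) (fun-cong (hom h) (q x))
    ; identityˡ = λ {A} {B} _ → Model.Eq.refl B
    ; identityʳ = λ {A} {B} _ → Model.Eq.refl B
    ; assoc = λ {A} {B} {C} {D} _ → Model.Eq.refl D
    }

  forget : Functor 𝕂 (Met ℓ)
  forget = record
    { F₀ = Model.space
    ; F₁ = hom
    ; F-resp-≈ = λ p → p
    ; identity = λ {A} _ → Model.Eq.refl A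
    ; homomorphism = λ {A} {B} {C} _ → Model.Eq.refl C
    }

  -- The free model on X: terms over X, where t ~[ ε ] s is the least family of
  -- relations making them a model of U with X included non-expansively.
  module Free (X : MetricSpace ℓ) where

    private
      module X = MetricSpace X

    infix 4 _~[_]_

    data _~[_]_ : Term Σ X.Carrier → ℚ≥0 → Term Σ X.Carrier → Set ℓ where
      ~var   : ∀ {x y ε} → X.d x y ≤ℚ ε → var x ~[ ε ] var y
      ~refl  : ∀ {t} → t ~[ 0# ] t
      ~sym   : ∀ {t s ε} → t ~[ ε ] s → s ~[ ε ] t
      ~trans : ∀ {t s u ε ε′} → t ~[ ε ] s → s ~[ ε′ ] u → t ~[ ε + ε′ ] u
      ~upper : ∀ {t s ε ε′} → ε ≤ ε′ → t ~[ ε ] s → t ~[ ε′ ] s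
      ~cont  : ∀ {t s ε} → (∀ ε′ → ε < ε′ → t ~[ ε′ ] s) → t ~[ ε ] s
      ~op    : ∀ {ε} f {ts ss} → (∀ i → ts i ~[ ε ] ss i) → op f ts ~[ ε ] op f ss
      ~axiom : ∀ {Γ t ε s} → Γ ⊢ (t =[ ε ] s) → (ι : ℕ → Term Σ X.Carrier) →
               (∀ t′ ε′ s′ → (t′ =[ ε′ ] s′) ∈ Γ → eval op ι t′ ~[ ε′ ] eval op ι s′) →
               eval op ι t ~[ ε ] eval op ι s

    distance : Term Σ X.Carrier → Term Σ X.Carrier → [0,∞] ℓ
    distance t s = record
      { Bound = λ ε → t ~[ ε ] s
      ; upper = λ _ _ → ~upper
      ; closed = λ _ → ~cont
      }

    termSpace : MetricSpace ℓ
    termSpace = record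
      { Carrier = Term Σ X.Carrier
      ; _≈_ = λ t s → t ~[ 0# ] s
      ; isEquivalence = record { refl = ~refl ; sym = ~sym ; trans = ~trans }
      ; d = distance
      ; d≐0⇒≈ = λ t s (z , _) → z 0# tt
      ; ≈⇒d≐0 = λ t s p → (λ ε _ → ~upper (nonNegative ε) p) , (λ _ _ → tt)
      ; symmetry = λ t s → (λ _ → ~sym) , (λ _ → ~sym)
      ; triangle = λ t s u → ⊞-elim (distance t s) (distance s u) (distance t u)
          λ p q → ~trans
      }

    model : Model
    model = record
      { algebra = record
        { space = termSpace
        ; interp = λ f → record { fun = op f ; nonExpansive = λ _ _ _ → ~op f }
        }
      ; satisfies = λ { Γ (t =[ ε ] s) ⊢φ ι h →
          ~axiom ⊢φ ι (λ t′ ε′ s′ m → h (t′ =[ ε′ ] s′) m) }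
      }

    module _ (A : Model) (f : X ⇒ Model.space A) where

      private
        module A = Model A

      extend : Term Σ X.Carrier → A.Carrier
      extend t = A.⟦ t ⟧ (fun f)

      extend-bind : (ι : ℕ → Term Σ X.Carrier) (t : Term Σ ℕ) →
                    extend (eval op ι t) A.≈ A.⟦ t ⟧ (λ x → extend (ι x))
      extend-bind ι (var x)   = A.Eq.refl
      extend-bind ι (op g ts) = fun-cong (A.interp g) (λ i → extend-bind ι (ts i))

      extend-nonExpansive : ∀ {t s ε} → t ~[ ε ] s → A.d (extend t) (extend s) ≤ℚ ε
      extend-nonExpansive (~var b) = nonExpansive f _ _ _ b
      extend-nonExpansive ~refl = A.d-refl A.Eq.refl _
      extend-nonExpansive (~sym p) = A.d-sym (extend-nonExpansive p)
      extend-nonExpansive (~trans p q) =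
        A.d-trans _ _ _ (extend-nonExpansive p) (extend-nonExpansive q)
      extend-nonExpansive (~upper le p) = upper (A.d _ _) _ _ le (extend-nonExpansive p)
      extend-nonExpansive (~cont h) =
        closed (A.d _ _) _ (λ ε′ lt → extend-nonExpansive (h ε′ lt))
      extend-nonExpansive (~op g h) =
        nonExpansive (A.interp g) _ _ _ (λ i → extend-nonExpansive (h i))
      extend-nonExpansive (~axiom {Γ} {t} {ε} {s} ⊢φ ι h) =
        A.d-resp (A.Eq.sym (extend-bind ι t)) (A.Eq.sym (extend-bind ι s))
          (A.satisfies Γ (t =[ ε ] s) ⊢φ (λ x → extend (ι x))
            λ { (t′ =[ ε′ ] s′) m → A.d-resp (extend-bind ι t′) (extend-bind ι s′)
                  (extend-nonExpansive (h t′ ε′ s′ m)) })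

      extendHom : ModelHomomorphism model A
      extendHom = record
        { hom = record
          { fun = extend
          ; nonExpansive = λ _ _ _ → extend-nonExpansive
          }
        ; hom-op = λ _ _ → A.Eq.refl
        }

      extend-unique : (h : ModelHomomorphism model A) →
                      (∀ x → fun (hom h) (var x) A.≈ fun f x) →
                      ∀ t → fun (hom h) t A.≈ extend t
      extend-unique h p (var x)   = p x
      extend-unique h p (op g ts) = A.Eq.trans (hom-op h g ts)
        (fun-cong (A.interp g) (λ i → extend-unique h p (ts i)))

    freeObject : FreeObject forget X
    freeObject = record
      { obj = model
      ; η = record { fun = var ; nonExpansive = λ _ _ _ → ~var }
      ; ext = λ {A} → extendHom A
      ; ext-η = λ {A} f x → Model.Eq.refl A
      ; ext-unique = λ {A} → extend-unique A
      }

  free : LeftAdjoint forget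
  free = leftAdjoint Free.freeObject

  private
    module L = LeftAdjoint free
    module TU = Monad (inducedMonad free)

    T-enriched : ∀ {X Y} (f g : X ⇒ Y) u →
                 MetricSpace.d (TU.T.F₀ Y) (fun (TU.T.F₁ f) u) (fun (TU.T.F₁ g) u) ⊑
                 MetricSpace.d (X ⟶ Y) f g
    T-enriched {X} {Y} f g (var x) ε b = Free.~var (b x)
    T-enriched {X} {Y} f g (op k ts) ε b = Free.~op k (λ i → T-enriched f g (ts i) ε b)

  -- The monad T_U induced by the free–forgetful adjunction.
  𝕋 : StrongMonad ℓ
  𝕋 = record
    { monad = inducedMonad free
    ; strength = pairing-strength TU.T T-enriched
    ; η-strong = λ X Y (x , y) → Free.~refl
    ; μ-strong = λ X Y (x , u) → μ-strong X Y x u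
    }
    where
    μ-strong : ∀ X Y x u → MetricSpace._≈_ (TU.T.F₀ (X □ Y))
      (fun (TU.μ.η (X □ Y)) (fun (TU.T.F₁ (Strength.t (pairing-strength TU.T T-enriched) X Y))
        (fun (TU.T.F₁ (pair X (TU.T.F₀ Y) x)) u)))
      (fun (TU.T.F₁ (pair X Y x)) (fun (TU.μ.η Y) u))
    μ-strong X Y x (var u)   = Free.~refl
    μ-strong X Y x (op k us) = Free.~op k (λ i → μ-strong X Y x (us i))

{-# OPTIONS --safe #-}
module Submission where

-- Over Met, tensor ⟨T_U , T_U′⟩-algebras are the same as models of U ⊗ U′, so the
-- free models of U ⊗ U′ are also free tensor algebras. From a tensor algebra (A, a, b)
-- one gets the operations x ↦ a (f x) and x ↦ b (g x); basicness makes them satisfy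
-- U and U′, and the tensor condition for the pre-operation φ ↦ f(φ), indexed by the
-- discrete space of arguments of f, says that f commutes with every operation of U′.
-- Conversely, every pre-operation of T_U is, by naturality, given on tuples by terms
-- over U, and these commute with the operations of U′ as soon as the operations of U do.

open import Level using (Level; Lift; lift; lower)
open import Defs
open import Data.Nat.Base as ℕ using (ℕ)
import Data.Nat.Properties as ℕ
open import Data.Fin.Base using (Fin; toℕ; fromℕ<; combine; remQuot)
open import Data.Fin.Properties using (fromℕ<-toℕ; toℕ<n; remQuot-combine)
open import Data.List.Base using (map)
open import Data.List.Membership.Propositional using (_∈_)
open import Data.List.Membership.Propositional.Properties
  using (∈-map⁺; ∈-map⁻; ∈-tabulate⁺)
open import Data.List.Relation.Unary.Any using (here; there)
open import Data.Product.Base using (_,_; proj₂; uncurry)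
open import Data.Rational.Base as ℚ using (1ℚ)
open import Data.Refinement.Base using (value) renaming (_,_ to _,ᵣ_)
open import Data.Irrelevant using ([_])
import Data.Rational.Properties as ℚ
open import Data.Sum.Base using (inj₁; inj₂)
open import Function.Base using () renaming (_∘_ to _∙_)
open import Relation.Binary.PropositionalEquality as ≡ using (_≡_; refl)
open import Relation.Nullary.Decidable.Core using (yes; no)
open import Relation.Nullary.Negation.Core using (contradiction)
import Relation.Binary.Reasoning.Setoid as SetoidReasoning

open Signature
open [0,∞]

private
  variable
    ℓ o o′ : Level

-- Terms and satisfaction

module _ {Σ : Signature ℓ} (N : QuantitativeAlgebra Σ) where

  open QuantitativeAlgebra N

  -- Induction on terms. `X` is a bare set with arbitrary operations `i`, so that `h` can be
  -- evaluation of terms (for substitutions and for renamed operation symbols), a structure map or a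
  -- homomorphism.
  eval-fusion : {V : Set o} {X : Set o′} {i : (f : Op Σ) → (Fin (arity Σ f) → X) → X}
                (h : X → Carrier) →
                (∀ f x → MetricSpace._≈_ space (h (i f x)) (fun (interp f) (h ∙ x))) →
                (ι : V → X) (t : Term Σ V) →
                MetricSpace._≈_ space (h (eval i ι t)) (⟦ t ⟧ (h ∙ ι))
  eval-fusion h p ι (var x)   = Eq.refl
  eval-fusion h p ι (op f ts) =
    Eq.trans (p f _) (fun-cong (interp f) (λ k → eval-fusion h p ι (ts k)))

  ⟦⟧-cong : {V : Set o} {ι κ : V → Carrier} → (∀ x → MetricSpace._≈_ space (ι x) (κ x)) →
            (t : Term Σ V) → MetricSpace._≈_ space (⟦ t ⟧ ι) (⟦ t ⟧ κ)
  ⟦⟧-cong p (var x)   = p x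
  ⟦⟧-cong p (op f ts) = fun-cong (interp f) (λ k → ⟦⟧-cong p (ts k))

algebraOn : {Σ : Signature ℓ} (A : MetricSpace ℓ) → ((f : Op Σ) → A ^ arity Σ f ⇒ A) →
            QuantitativeAlgebra Σ
algebraOn A i = record { space = A ; interp = i }

-- One transfer argument for two uses: substitution, where `i` is the interpretation in `M` and `κ`
-- holds the values of the substituted terms, and the inclusion of a summand signature, where the
-- assignment stays the same.
module Translation {Σ Σ′ : Signature ℓ} (M : QuantitativeAlgebra Σ)
  (i : (f : Op Σ′) → QuantitativeAlgebra.space M ^ arity Σ′ f ⇒ QuantitativeAlgebra.space M)
  where

  private
    module M = QuantitativeAlgebra M
    N = algebraOn M.space i
    module N = QuantitativeAlgebra N

  module _ (h : Term Σ′ ℕ → Term Σ ℕ) (ι κ : ℕ → M.Carrier)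
           (p : ∀ t → M.⟦ h t ⟧ ι M.≈ N.⟦ t ⟧ κ) where

    translate⁺ : ∀ φ → κ N.⊨ φ → ι M.⊨ mapEq h φ
    translate⁺ (t =[ ε ] s) = M.d-resp (M.Eq.sym (p t)) (M.Eq.sym (p s))

    translate⁻ : ∀ φ → ι M.⊨ mapEq h φ → κ N.⊨ φ
    translate⁻ (t =[ ε ] s) = M.d-resp (p t) (p s)

    translate-hyps⁺ : ∀ Γ → (∀ ψ → ψ ∈ Γ → κ N.⊨ ψ) →
                      ∀ ψ → ψ ∈ map (mapEq h) Γ → ι M.⊨ ψ
    translate-hyps⁺ Γ hyps ψ m with ∈-map⁻ (mapEq h) m
    ... | χ , m′ , refl = translate⁺ χ (hyps χ m′)

    translate-hyps⁻ : ∀ Γ → (∀ ψ → ψ ∈ map (mapEq h) Γ → ι M.⊨ ψ) →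
                      ∀ ψ → ψ ∈ Γ → κ N.⊨ ψ
    translate-hyps⁻ Γ hyps ψ m = translate⁻ ψ (hyps _ (∈-map⁺ (mapEq h) m))

  module _ (h : Term Σ′ ℕ → Term Σ ℕ) (p : ∀ ι t → M.⟦ h t ⟧ ι M.≈ N.⟦ t ⟧ ι) where

    satisfies⁺ : ∀ Γ φ → N.Satisfies Γ φ → M.Satisfies (map (mapEq h) Γ) (mapEq h φ)
    satisfies⁺ Γ φ sat ι hyps =
      translate⁺ h ι ι (p ι) φ (sat ι (translate-hyps⁻ h ι ι (p ι) Γ hyps))

    satisfies⁻ : ∀ Γ φ → M.Satisfies (map (mapEq h) Γ) (mapEq h φ) → N.Satisfies Γ φ
    satisfies⁻ Γ φ sat ι hyps =
      translate⁻ h ι ι (p ι) φ (sat ι (translate-hyps⁺ h ι ι (p ι) Γ hyps))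

-- Soundness of deduction, packaged as a theory: if the axioms of a theory hold in `M`, then
-- leastness puts the whole theory inside this one.
satisfaction : {Σ : Signature ℓ} → QuantitativeAlgebra Σ → Theory Σ
satisfaction {Σ = Σ} M = record
  { _⊢_ = Satisfies
  ; isTheory = record
    { reflexivity  = λ x ι _ → d-refl Eq.refl 0#
    ; symmetry     = λ x y ε ι hyps → d-sym (hyps _ (here refl))
    ; triangle     = λ x y z ε ε′ ι hyps →
        d-trans (ι z) ε ε′ (hyps _ (here refl)) (hyps _ (there (here refl)))
    ; weakening    = λ x y ε ε′ _ ι hyps →
        upper (d (ι x) (ι y)) ε (ε + ε′) (p≤p+q ε ε′) (hyps _ (here refl))
    ; congruence   = λ f x y ε ι hyps → nonExpansive (interp f) _ _ ε λ k →
        hyps _ (∈-tabulate⁺ {f = λ k → var (x k) =[ ε ] var (y k)} k)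
    ; continuity   = λ Γ t s ε sat ι hyps →
        closed (d (⟦ t ⟧ ι) (⟦ s ⟧ ι)) ε (λ ε′ lt → sat ε′ lt ι hyps)
    ; substitution = λ Γ φ σ sat ι hyps →
        let κ = λ x → ⟦ σ x ⟧ ι
            p = eval-fusion M (λ t → ⟦ t ⟧ ι) (λ f x → Eq.refl) σ
        in translate⁺ (_[ σ ]) ι κ p φ (sat κ (translate-hyps⁻ (_[ σ ]) ι κ p Γ hyps))
    ; assumption   = λ Γ φ m ι hyps → hyps φ m
    ; cut          = λ Γ Θ ψ cuts sat ι hyps → sat ι (λ φ m → cuts φ m ι hyps)
    }
  }
  where
  open QuantitativeAlgebra M
  open Translation M interp

-- Models and Eilenberg–Moore algebras

module _ {Σ : Signature ℓ} (U : Theory Σ) where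

  open Free U using (termSpace; extendHom; ~var; ~op; ~axiom)
  private
    module T = StrongMonad (𝕋 U)

  evaluation : (M : Model U) → termSpace (Model.space M) ⇒ Model.space M
  evaluation M = ModelHomomorphism.hom (extendHom (Model.space M) M id)

  evaluation-T : (M : Model U) {X : MetricSpace ℓ} (h : X ⇒ Model.space M) (t : Term Σ ∣ X ∣) →
                 Model._≈_ M (fun (evaluation M) (fun (T.T.F₁ h) t)) (Model.⟦_⟧ M t (fun h))
  evaluation-T M h = eval-fusion (Model.algebra M) (fun (evaluation M))
    (λ _ _ → Model.Eq.refl M) (var ∙ fun h)

  evaluation-isEilenbergMoore : (M : Model U) → IsEilenbergMoore T.monad (evaluation M)
  evaluation-isEilenbergMoore M = record
    { unit = λ _ → Model.Eq.refl M
    ; mult = λ t → Model.Eq.trans M (evaluation-T M (evaluation M) t)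
        (Model.Eq.sym M (eval-fusion (Model.algebra M) (fun (evaluation M))
          (λ _ _ → Model.Eq.refl M) (λ x → x) t))
    }

  module _ {A : MetricSpace ℓ} (a : termSpace A ⇒ A) where

    private
      module A = MetricSpace A

    operation : ∀ f → A ^ arity Σ f ⇒ A
    operation f = record
      { fun = λ x → fun a (op f (var ∙ x))
      ; nonExpansive = λ x y ε b → nonExpansive a _ _ ε (~op f (λ k → ~var (b k)))
      }

    module EilenbergMoore (em : IsEilenbergMoore T.monad a) where

      open IsEilenbergMoore em
      private
        N = algebraOn A operation
        module N = QuantitativeAlgebra N

      -- The multiplication law at the two-level term `op f (var ∙ x)` says that `a` preserves `f`,
      -- so `a` is a homomorphism from the terms over `A` to `N`.
      structure-bind : {V : Set o} (ι : V → ∣ termSpace A ∣) (t : Term Σ V) →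
                       fun a (eval op ι t) A.≈ N.⟦ t ⟧ (fun a ∙ ι)
      structure-bind = eval-fusion N (fun a) λ f x → A.Eq.sym (mult (op f (var ∙ x)))

      -- With `h = id` this recovers `a` as evaluation of terms in `N`: an Eilenberg-Moore structure
      -- is determined by its operations.
      structure-T : {X : MetricSpace ℓ} (h : X ⇒ A) (t : Term Σ ∣ X ∣) →
                    fun a (fun (T.T.F₁ h) t) A.≈ N.⟦ t ⟧ (fun h)
      structure-T h t = A.Eq.trans (structure-bind (var ∙ fun h) t)
        (⟦⟧-cong N (λ x → unit (fun h x)) t)

      -- The premises of an axiom compare variables only, so that their validity
      -- in A already makes them valid between generators in the free model on A.
      satisfies : IsBasic U → ∀ Γ φ → Theory._⊢_ U Γ φ → N.Satisfies Γ φ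
      satisfies (B , basic , B⊆U , least) = least (satisfaction N) sound
        where
        sound : ∀ Γ φ → B Γ φ → N.Satisfies Γ φ
        sound Γ φ@(t =[ ε ] s) b ι hyps = A.d-resp (bind t) (bind s)
          (nonExpansive a _ _ ε (~axiom (B⊆U Γ φ b) (var ∙ ι) premise))
          where
          bind : ∀ t → fun a (eval op (var ∙ ι) t) A.≈ N.⟦ t ⟧ ι
          bind t = A.Eq.trans (structure-bind (var ∙ ι) t) (⟦⟧-cong N (λ x → unit (ι x)) t)
          premise : ∀ t′ ε′ s′ → (t′ =[ ε′ ] s′) ∈ Γ →
                    Free._~[_]_ U A (eval op (var ∙ ι) t′) ε′ (eval op (var ∙ ι) s′)
          premise t′ ε′ s′ m with basic Γ φ b _ m
          ... | x , y , _ , refl = ~var (hyps _ m)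

-- Pre-operations

-- Distinct points have no bound, hence distance ∞. Every function out of this space is
-- non-expansive, so maps from it to `A` are exactly `n`-tuples in `A`.
discrete : ℕ → MetricSpace ℓ
discrete {ℓ} n = record
  { Carrier = Lift ℓ (Fin n)
  ; _≈_ = _≡_
  ; isEquivalence = ≡.isEquivalence
  ; d = λ x y → record
    { Bound = λ _ → x ≡ y
    ; upper = λ _ _ _ p → p
    -- The bound ignores the tolerance, so a single strictly larger one suffices.
    ; closed = λ ε h → h (ε + 1#) (ε<ε+1 ε)
    }
  ; d≐0⇒≈ = λ x y (z , _) → z 0# _
  ; ≈⇒d≐0 = λ x y p → (λ _ _ → p) , _
  ; symmetry = λ x y → (λ _ → ≡.sym) , (λ _ → ≡.sym)
  ; triangle = λ x y z ε b → let _ , _ , p , q , _ = b (ε + 1#) (ε<ε+1 ε) in ≡.trans p q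
  }
  where
  1# : ℚ≥0
  1# = 1ℚ ,ᵣ [ ℚ.nonNegative⁻¹ 1ℚ ]
  ε<ε+1 : ∀ ε → ε < ε + 1#
  ε<ε+1 ε = ≡.subst (ℚ._< value ε ℚ.+ 1ℚ) (ℚ.+-identityʳ (value ε))
    (ℚ.+-monoʳ-< (value ε) (ℚ.positive⁻¹ 1ℚ))

fromFin : (n : ℕ) {A : MetricSpace ℓ} → (Fin n → ∣ A ∣) → discrete n ⇒ A
fromFin n {A} x = record
  { fun = λ k → x (lower k)
  ; nonExpansive = λ k l ε k≡l → MetricSpace.d-refl A
      (MetricSpace.Eq.reflexive A (≡.cong (x ∙ lower) k≡l)) ε
  }

preOperation : {Σ : Signature ℓ} (U : Theory Σ) (f : Op Σ) →
               PreOperation (discrete (arity Σ f)) (StrongMonad.strength (𝕋 U))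
preOperation {Σ = Σ} U f = record
  { transformation = record
    { η = λ X → record
      { fun = λ φ → op f (λ k → var (fun φ (lift k)))
      ; nonExpansive = λ φ ψ ε b → Free.~op f (λ k → Free.~var (b (lift k)))
      }
    ; commute = λ h φ → Free.~refl
    }
  ; isStrong = λ X Y (x , φ) → Free.~refl
  }

-- From models to tensor algebras

Commute : {A : MetricSpace ℓ} {n m : ℕ} → A ^ n ⇒ A → A ^ m ⇒ A → Set ℓ
Commute {A = A} {n} {m} f g = (x : Fin n → Fin m → ∣ A ∣) → MetricSpace._≈_ A
  (fun f (λ i → fun g (λ j → x i j))) (fun g (λ j → fun f (λ i → x i j)))

module _ {Σ : Signature ℓ} (N : QuantitativeAlgebra Σ) where

  open QuantitativeAlgebra N

  -- Operations commuting with `g` are closed under composition. The variables of `t` are tuples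
  -- themselves because naturality presents the value of a pre-operation as a term over `space ^ m`.
  ⟦⟧-commute : {m : ℕ} (g : space ^ m ⇒ space) → (∀ f → Commute (interp f) g) →
               (t : Term Σ (Fin m → Carrier)) →
               MetricSpace._≈_ space (⟦ t ⟧ (fun g)) (fun g (λ j → ⟦ t ⟧ (λ x → x j)))
  ⟦⟧-commute g comm (var x)   = Eq.refl
  ⟦⟧-commute g comm (op f ts) =
    Eq.trans (fun-cong (interp f) (λ i → ⟦⟧-commute g comm (ts i))) (comm f _)

prefix : {A : Set o} {n : ℕ} → A → (Fin n → A) → ℕ → A
prefix {n = n} a x k with k ℕ.<? n
... | yes k<n = x (fromℕ< k<n)
... | no  _   = a

prefix-toℕ : {A : Set o} {n : ℕ} (a : A) (x : Fin n → A) (k : Fin n) →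
             prefix a x (toℕ k) ≡ x k
prefix-toℕ {n = n} a x k with toℕ k ℕ.<? n
... | yes k<n = ≡.cong x (fromℕ<-toℕ k k<n)
... | no  k≮n = contradiction (toℕ<n k) k≮n

module _ {Σ Σ′ : Signature ℓ} (U : Theory Σ) (U′ : Theory Σ′) where

  private
    module T  = StrongMonad (𝕋 U)
    module T′ = StrongMonad (𝕋 U′)

  module FromModel (M : Model (U ⊗ U′)) where

    private
      module M = Model M

    -- Members of `U` become axioms of `U ⊗ U′` under `injˡ`, and an injected term has the same
    -- value in `M` as the original has in the reduct.
    reductˡ : Model U
    reductˡ = record
      { algebra = algebraOn M.space i
      ; satisfies = λ Γ φ ⊢φ → Translation.satisfies⁻ M.algebra i injˡ
          (λ ι → eval-fusion (algebraOn M.space i) (λ t → M.⟦ t ⟧ ι) (λ _ _ → M.Eq.refl) var)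
          Γ φ
          (M.satisfies _ _ (axiom _ _ (left Γ φ ⊢φ)))
      }
      where
      i : ∀ f → M.space ^ arity Σ f ⇒ M.space
      i f = M.interp (inj₁ f)

    reductʳ : Model U′
    reductʳ = record
      { algebra = algebraOn M.space i
      ; satisfies = λ Γ φ ⊢φ → Translation.satisfies⁻ M.algebra i injʳ
          (λ ι → eval-fusion (algebraOn M.space i) (λ t → M.⟦ t ⟧ ι) (λ _ _ → M.Eq.refl) var)
          Γ φ
          (M.satisfies _ _ (axiom _ _ (right Γ φ ⊢φ)))
      }
      where
      i : ∀ f → M.space ^ arity Σ′ f ⇒ M.space
      i f = M.interp (inj₂ f)

    -- The variables x i j of the commutation axiom are read off the numbering of
    -- pairs by Fin (n * m); the left-hand side itself serves as the value of all
    -- other variables, so that M need not be assumed inhabited.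
    interp-commute : ∀ f g → Commute (M.interp (inj₁ f)) (M.interp (inj₂ g))
    interp-commute f g x = begin
      F (λ i → G (λ j → x i j))               ≈⟨ fun-cong (M.interp (inj₁ f)) (λ i →
                                                   fun-cong (M.interp (inj₂ g)) (λ j → ι-index i j)) ⟨
      F (λ i → G (λ j → ι (index i j)))       ≈⟨ M.d-zero (M.satisfies _ _
                                                   (axiom _ _ (commutation f g index)) ι λ _ ()) ⟩
      G (λ j → F (λ i → ι (index i j)))       ≈⟨ fun-cong (M.interp (inj₂ g)) (λ j →
                                                   fun-cong (M.interp (inj₁ f)) (λ i → ι-index i j)) ⟩
      G (λ j → F (λ i → x i j))               ∎
      where
      open SetoidReasoning M.setoid
      n = arity Σ f
      m = arity Σ′ g
      F = fun (M.interp (inj₁ f))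
      G = fun (M.interp (inj₂ g))
      index : Fin n → Fin m → ℕ
      index i j = toℕ (combine i j)
      y : Fin (n ℕ.* m) → M.Carrier
      y k = uncurry x (remQuot m k)
      ι : ℕ → M.Carrier
      ι = prefix (F (λ i → G (x i))) y
      ι-index : ∀ i j → ι (index i j) M.≈ x i j
      ι-index i j = M.Eq.reflexive (≡.trans (prefix-toℕ _ y (combine i j))
        (≡.cong (uncurry x) (remQuot-combine i j)))

    a : Free.termSpace U M.space ⇒ M.space
    a = evaluation U reductˡ

    b : Free.termSpace U′ M.space ⇒ M.space
    b = evaluation U′ reductʳ

    -- By naturality, g on a tuple of v-indexed families is the reindexing of one
    -- term over M ^ m, on which f acts through ⟦⟧-commute.
    preOperation-homomorphism : (v : MetricSpace ℓ) (g : PreOperation v T.strength) →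
      IsHomomorphism T′.T (power T′.strength v b) b (a ∘ PreOperation.η g M.space)
    preOperation-homomorphism v g = go
      where
      module g = PreOperation g
      h : (v ⟶ M.space) ⇒ M.space
      h = a ∘ g.η M.space
      b̄ = power T′.strength v b
      go : ∀ u → fun h (fun b̄ u) M.≈ fun b (fun (T′.T.F₁ h) u)
      go (var φ)   = fun-cong h λ p → M.Eq.refl
      go (op f us) = begin
        fun h (fun b̄ (op f us))                     ≈⟨ fun-cong h (λ p → M.Eq.refl) ⟩
        fun h (F ∘ Φ)                               ≈⟨ factor F ⟩
        M⟦ fun (g.η (M.space ^ m)) Φ ⟧ (fun F)      ≈⟨ ⟦⟧-commute (Model.algebra reductˡ) F
                                                         (λ k → interp-commute k f)
                                                         (fun (g.η (M.space ^ m)) Φ) ⟩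
        fun F (λ j → M⟦ fun (g.η (M.space ^ m)) Φ ⟧ (λ x → x j))
                                                    ≈⟨ fun-cong F (λ j → factor (π j)) ⟨
        fun F (λ j → fun h (π j ∘ Φ))               ≈⟨ fun-cong F (λ j → fun-cong h (λ p → M.Eq.refl)) ⟩
        fun F (λ j → fun h (fun b̄ (us j)))          ≈⟨ fun-cong F (λ j → go (us j)) ⟩
        fun b (fun (T′.T.F₁ h) (op f us))           ∎
        where
        open SetoidReasoning M.setoid
        m = arity Σ′ f
        F = M.interp (inj₂ f)
        M⟦_⟧ = Model.⟦_⟧ reductˡ
        -- Bundling the `m` families into one map lets naturality of `g` apply along `F` and along
        -- every projection `π j` at the same `Φ`.
        Φ : v ⇒ M.space ^ m
        Φ = record
          { fun = λ p j → fun (fun b̄ (us j)) p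
          ; nonExpansive = λ p q ε c j → nonExpansive (fun b̄ (us j)) p q ε c
          }
        π : Fin m → M.space ^ m ⇒ M.space
        π j = record { fun = λ x → x j ; nonExpansive = λ x y ε c → c j }
        factor : (k : M.space ^ m ⇒ M.space) →
                 fun h (k ∘ Φ) M.≈ M⟦ fun (g.η (M.space ^ m)) Φ ⟧ (fun k)
        factor k = M.Eq.trans (fun-cong a (g.commute k Φ))
          (evaluation-T U reductˡ k (fun (g.η (M.space ^ m)) Φ))

    tensorAlgebra : TensorAlgebra (𝕋 U) (𝕋 U′)
    tensorAlgebra = record
      { space = M.space
      ; a = a
      ; b = b
      ; a-isEilenbergMoore = evaluation-isEilenbergMoore U reductˡ
      ; b-isEilenbergMoore = evaluation-isEilenbergMoore U′ reductʳ
      ; tensor = preOperation-homomorphism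
      }

  -- From tensor algebras to models

  open FromModel using (reductˡ; reductʳ; tensorAlgebra)

  module ToModel (basic : IsBasic U) (basic′ : IsBasic U′)
                 (B : TensorAlgebra (𝕋 U) (𝕋 U′)) where

    private
      module B = TensorAlgebra B
      module A = MetricSpace B.space

    interpretation : ∀ f → B.space ^ arity (Σ ⊕ Σ′) f ⇒ B.space
    interpretation (inj₁ f) = operation U B.a f
    interpretation (inj₂ f) = operation U′ B.b f

    algebra : QuantitativeAlgebra (Σ ⊕ Σ′)
    algebra = algebraOn B.space interpretation

    private
      module N = QuantitativeAlgebra algebra

    satisfies-axioms : ∀ Γ φ → TensorAxioms U U′ Γ φ → N.Satisfies Γ φ
    satisfies-axioms _ _ (left Γ φ ⊢φ) =
      Translation.satisfies⁺ algebra (operation U B.a) injˡ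
        (λ ι → eval-fusion (algebraOn B.space (operation U B.a)) (λ t → N.⟦ t ⟧ ι)
          (λ _ _ → A.Eq.refl) var) Γ φ
        (EilenbergMoore.satisfies U B.a B.a-isEilenbergMoore basic Γ φ ⊢φ)
    satisfies-axioms _ _ (right Γ φ ⊢φ) =
      Translation.satisfies⁺ algebra (operation U′ B.b) injʳ
        (λ ι → eval-fusion (algebraOn B.space (operation U′ B.b)) (λ t → N.⟦ t ⟧ ι)
          (λ _ _ → A.Eq.refl) var) Γ φ
        (EilenbergMoore.satisfies U′ B.b B.b-isEilenbergMoore basic′ Γ φ ⊢φ)
    -- On `g` applied to the columns of `x`, seen as maps out of the discrete space, the tensor
    -- condition unfolds to this very equation.
    satisfies-axioms _ _ (commutation f g x) ι _ = A.d-refl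
      (B.tensor (discrete (arity Σ f)) (preOperation U f)
        (op g (λ j → var (fromFin (arity Σ f) (λ i → ι (x i j)))))) 0#

    model : Model (U ⊗ U′)
    model = record
      { algebra = algebra
      ; satisfies =
          proj₂ (generated-smallest (TensorAxioms U U′)) (satisfaction algebra) satisfies-axioms
      }

    module _ (M : Model (U ⊗ U′)) where

      -- A map preserving all operations preserves values of terms, and by `structure-T` the
      -- structure maps of `B` are evaluations.
      toTensorHom : ModelHomomorphism (U ⊗ U′) M model →
                    TensorHomomorphism (𝕋 U) (𝕋 U′) (tensorAlgebra M) B
      toTensorHom h = record
        { hom = hom
        ; hom-a = λ t → A.Eq.trans
            (eval-fusion (algebraOn B.space (operation U B.a)) (fun hom)
              (λ f → hom-op (inj₁ f)) (λ x → x) t)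
            (A.Eq.sym (EilenbergMoore.structure-T U B.a B.a-isEilenbergMoore hom t))
        ; hom-b = λ t → A.Eq.trans
            (eval-fusion (algebraOn B.space (operation U′ B.b)) (fun hom)
              (λ f → hom-op (inj₂ f)) (λ x → x) t)
            (A.Eq.sym (EilenbergMoore.structure-T U′ B.b B.b-isEilenbergMoore hom t))
        }
        where open ModelHomomorphism h

      -- Conversely, preservation of `f` is the homomorphism condition at the one-level term
      -- `op f (var ∙ x)`.
      toModelHom : TensorHomomorphism (𝕋 U) (𝕋 U′) (tensorAlgebra M) B →
                   ModelHomomorphism (U ⊗ U′) M model
      toModelHom h = record
        { hom = hom
        ; hom-op = λ { (inj₁ f) x → hom-a (op f (var ∙ x))
                     ; (inj₂ f) x → hom-b (op f (var ∙ x)) }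
        }
        where open TensorHomomorphism h

  -- Free tensor algebras and the isomorphism of monads

  module _ (basic : IsBasic U) (basic′ : IsBasic U′) where

    open ToModel basic basic′ using (model; toTensorHom; toModelHom)

    -- `toTensorHom` and `toModelHom` keep the underlying map, so the universal property of the free
    -- model carries over unchanged.
    freeTensorAlgebra : ∀ X → FreeObject (forgetTensor (𝕋 U) (𝕋 U′)) X
    freeTensorAlgebra X = record
      { obj = tensorAlgebra F.obj
      ; η = F.η
      ; ext = λ {B} f → toTensorHom B F.obj (F.ext {model B} f)
      ; ext-η = λ {B} → F.ext-η {model B}
      ; ext-unique = λ {B} f h → F.ext-unique {model B} f (toModelHom B F.obj h)
      }
      where module F = FreeObject (Free.freeObject (U ⊗ U′) X)

    tensorAdjoint : LeftAdjoint (forgetTensor (𝕋 U) (𝕋 U′))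
    tensorAdjoint = leftAdjoint freeTensorAlgebra

    private
      module S = Monad (inducedMonad {G = forgetTensor (𝕋 U) (𝕋 U′)} tensorAdjoint)
      module R = StrongMonad (𝕋 (U ⊗ U′))
      module F X = Model (Free.model (U ⊗ U′) X)

    -- Interpreting an operation f as the evaluation of f applied to variables gives
    -- f back, so passing to the tensor algebra and back does not change evaluation.
    model-tensorAlgebra : (M : Model (U ⊗ U′)) {V : Set ℓ} (ι : V → ∣ Model.space M ∣)
      (t : Term (Σ ⊕ Σ′) V) →
      Model._≈_ M (Model.⟦_⟧ (model (tensorAlgebra M)) t ι) (Model.⟦_⟧ M t ι)
    model-tensorAlgebra M ι (var x) = Model.Eq.refl M
    model-tensorAlgebra M ι (op (inj₁ f) ts) =
      fun-cong (Model.interp M (inj₁ f)) (λ k → model-tensorAlgebra M ι (ts k))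
    model-tensorAlgebra M ι (op (inj₂ f) ts) =
      fun-cong (Model.interp M (inj₂ f)) (λ k → model-tensorAlgebra M ι (ts k))

    -- Both monads have the same spaces and units, so the components are identities. Only the
    -- extensions differ: one evaluates in `model (tensorAlgebra M)`, the other in `M`.
    monadIso : MonadIso (inducedMonad {G = forgetTensor (𝕋 U) (𝕋 U′)} tensorAdjoint)
      (StrongMonad.monad (𝕋 (U ⊗ U′)))
    monadIso = record
      { σ = record
        { η = λ X → id
        ; commute = λ {X} {Y} f t →
            model-tensorAlgebra (Free.model (U ⊗ U′) Y) (fun (R.η.η Y ∘ f)) t
        }
      ; τ = λ X → id
      ; isoˡ = λ X t → F.Eq.refl X {t}
      ; isoʳ = λ X t → F.Eq.refl X {t}
      ; unit-∘ = λ X x → F.Eq.refl X {var x}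
      ; mult-∘ = λ X t → F.Eq.trans X
          (model-tensorAlgebra (Free.model (U ⊗ U′) X) (λ t → t) t)
          -- This inserts the factor `S.T.F₁ id` demanded by the multiplication law.
          (fun-cong (R.μ.η X) (F.Eq.sym (F.space X) (S.T.identity {F.space X} t)))
      }

theorem6p16 : {ℓ : Level} (Σ Σ′ : Signature ℓ) (U : Theory Σ) (U′ : Theory Σ′) →
    IsBasic U → IsBasic U′ →
    IsTensor (𝕋 U) (𝕋 U′) (StrongMonad.monad (𝕋 (U ⊗ U′)))
theorem6p16 Σ Σ′ U U′ basic basic′ =
  tensorAdjoint U U′ basic basic′ , monadIso U U′ basic basic′
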